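{- D$_0$ graphs (regarded as signed, colored graphs) satisfy axioms 1, 2, 3, $4'a$ and LSP$_4$ and LSP$_5$. Hence a D$_0$ graph is a D graph if and only if it satisfies axioms $4'b$ and 5.
   Context: Words are in $\{1,\dots,N\}$; $\mathcal{W}_n$ is the set of words of length $n$ with no repeated letter. A D$_0$ graph of degree $n$ is a graph on $W\subseteq\mathcal{W}_n$ with edges colored from $\{2,\dots,n-1\}$ such that (i) each $i$-edge is one of $\{vbacw,vbcaw\}$, $\{vacbw,vcabw\}$, $\{vbacw,vacbw\}$, $\{vbcaw,vcabw\}$ for letters $a<b<c$ and words $v,w$ with $v$ of length $i-2$; (ii) for all such $a<b<c$, $v,w$, each element of $W\cap\{vbacw,vbcaw,vacbw,vcabw\}$ belongs to exactly one $i$-edge. It is regarded as a signed, colored graph with signature $\sigma(w)_i=+1$ if $w_i<w_{i+1}$, $-1$ otherwise. A signed, colored graph of degree $n$: a graph with vertex set $V$, edges colored from $\{2,\dots,n-1\}$, signature $\sigma:V\to\{\pm1\}^{n-1}$; generating function $\sum_{v}Q_{\{i:\sigma(v)_i=-1\}}(\mathbf{x})$ with $Q_S(\mathbf{x})=\sum x_{i_1}\cdots x_{i_n}$ over $1\le i_1\le\cdots\le i_n$, $i_j<i_{j+1}$ for $j\in S$. Axiom 0: each vertex lies on at most one $i$-edge for each $i$; then $E_i(v)=w$ means $\{v,w\}$ is an $i$-edge, $v$ admits an $i$-neighbor if such $w$ exists, and all expressions $E_{i_1}\cdots E_{i_r}(v)$ used must be defined. $\mathrm{Res}_K\mathcal{G}$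 for $K=\{i,\dots,j\}$: same vertices, signature $\hat\sigma(v)_s=\sigma(v)_{s+i-1}$ ($s\in[j-i]$), an $(s-i+1)$-edge for each $s$-edge with $i+1\le s\le j-1$; $\mathrm{Res}_K(\mathcal{G},w)$ its component containing $w$. LSP$_d$: every component of every $\mathrm{Res}_K\mathcal{G}$ with $|K|=d$ has Schur positive generating function. $v$ has $i$-type W if it admits an $i$- and an $(i-1)$-neighbor and $\sigma(v)_i=-\sigma(E_{i-1}(v))_i$. For $4\le i<n$, a flat $i$-chain is a sequence $(x^1,\dots,x^{2h})$ of distinct vertices admitting $(i-2)$-neighbors with $x^{2j-1}=E_i(x^{2j})$ and $x^{2j+1}=E_{i-2}(E_{i-1}E_{i-2})^{m_j}(x^{2j})$ for nonnegative integers $m_j$ with $(E_{i-1}E_{i-2})^{m_j}(x^{2j})$ not of $(i-1)$-type W. Axioms: (1) axiom 0 and $w$ admits an $i$-neighbor iff $\sigma(w)_{i-1}=-\sigma(w)_i$; (2) for each $i$-edge $\{w,x\}$, $\sigma(w)_j=-\sigma(x)_j$ for $j=i-1,i$ and $\sigma(w)_h=\sigma(x)_h$ for $h<i-2$, $h>i+1$; (3) for each $i$-edge $\{w,x\}$, if $\sigma(w)_{i-2}=-\sigma(x)_{i-2}$ then $\sigma(w)_{i-2}=-\sigma(w)_{i-1}$, and if $\sigma(w)_{i+1}=-\sigma(x)_{i+1}$ then $\sigma(w)_{i+1}=-\sigma(w)_i$; ($4'a$) for every $w$ admitting an $(i-1)$-neighbor $v$ with $\{w,v\}$ not an $i$-edge,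 $\sigma(w)_{i-3}\ne\sigma(v)_{i-3}$, $\sigma(w)_i\ne\sigma(v)_i$, the generating functions of $\mathrm{Res}_{[i-3,i]}(\mathcal{G},w)$ and $\mathrm{Res}_{[i-2,i+1]}(\mathcal{G},w)$ agree; ($4'b$) if $(x^1,\dots,x^{2h})$ is a flat $i$-chain and $x^j$ has $(i+1)$-type W for some $2<j<2h-1$, then all of $x^1,\dots,x^j$ or all of $x^j,\dots,x^{2h}$ have $(i+1)$-type W; (5) if $\{w,x\}$ is an $i$-edge and $\{x,y\}$ a $j$-edge with $|i-j|\ge3$, there is $v$ with $\{w,v\}$ a $j$-edge and $\{v,y\}$ an $i$-edge. A D graph is a signed, colored graph satisfying axioms 1, 2, 3, $4'a$, $4'b$, 5, LSP$_4$ and LSP$_5$. -}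

module Defs where

open import Data.Nat using (ℕ; zero; suc; _+_; _*_; _∸_; _≤_; _<_; _<ᵇ_; _≡ᵇ_; _⊔_)
open import Data.Bool using (Bool; true; false; T; _∧_; if_then_else_)
open import Data.List using (List; []; _∷_; _++_; length; map; concatMap; filterᵇ; upTo; foldr; concat; [_])
open import Data.Nat.ListAction using (sum)
open import Data.List.Relation.Unary.All using (All)
open import Data.List.Relation.Unary.Linked using (Linked)
open import Data.List.Relation.Unary.Unique.Propositional using (Unique)
open import Data.List.Membership.Propositional using (_∈_)
open import Data.Product using (Σ; ∃; _×_; _,_)
open import Data.Sum using (_⊎_)
open import Relation.Binary.PropositionalEquality using (_≡_; _≢_)
open import Relation.Binary.Construct.Closure.ReflexiveTransitive using (Star)
open import Relation.Nullary using (¬_)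
open import Relation.Nullary.Decidable using (⌊_⌋)

data Sign : Set where
  plus minus : Sign

neg : Sign → Sign
neg plus  = minus
neg minus = plus

-- Quasisymmetric / symmetric functions, represented by their
-- coefficients on monomials.  A monomial x_{a_1} ... x_{a_d} of degree d
-- is a weakly increasing list (a_1 ≤ ... ≤ a_d) of positive integers.

IsMonomial : ℕ → List ℕ → Set
IsMonomial d α = length α ≡ d × All (λ a → 1 ≤ a) α × Linked _≤_ α

-- Coefficient of the monomial α in Q_S, where S = {j : s j ≡ minus}
-- (only j ∈ [d-1] matter, d = length α): it is 1 iff a_j < a_{j+1}
-- for every j ∈ S.
isMinus : Sign → Bool
isMinus plus  = false
isMinus minus = true

qOK : (ℕ → Sign) → ℕ → List ℕ → Bool
qOK s j (a ∷ b ∷ rest) =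
  (if isMinus (s j) then a <ᵇ b else true) ∧ qOK s (suc j) (b ∷ rest)
qOK s j _ = true

qCoeff : (ℕ → Sign) → List ℕ → ℕ
qCoeff s α = if qOK s 1 α then 1 else 0

IsPartition : ℕ → List ℕ → Set
IsPartition d λ′ = sum λ′ ≡ d × All (λ a → 1 ≤ a) λ′ × Linked (λ a b → b ≤ a) λ′

-- Semistandard Young tableaux of shape λ (rows listed top to bottom,
-- English notation), entries in {1..M}.
allLists : ℕ → ℕ → List (List ℕ)
allLists zero    M = [ [] ]
allLists (suc k) M = concatMap (λ a → map (a ∷_) (allLists k M)) (map suc (upTo M))

fillings : List ℕ → ℕ → List (List (List ℕ))
fillings []        M = [ [] ]
fillings (r ∷ λ′)  M = concatMap (λ row → map (row ∷_) (fillings λ′ M)) (allLists r M)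

weakInc : List ℕ → Bool
weakInc (a ∷ b ∷ rest) = (a <ᵇ suc b) ∧ weakInc (b ∷ rest)
weakInc _ = true

strictBelow : List ℕ → List ℕ → Bool
strictBelow (a ∷ r₁) (b ∷ r₂) = (a <ᵇ b) ∧ strictBelow r₁ r₂
strictBelow []       (b ∷ r₂) = false
strictBelow r₁       []       = true

columnsOK : List (List ℕ) → Bool
columnsOK (r₁ ∷ r₂ ∷ rest) = strictBelow r₁ r₂ ∧ columnsOK (r₂ ∷ rest)
columnsOK _ = true

allB : {A : Set} → (A → Bool) → List A → Bool
allB p []       = true
allB p (x ∷ xs) = p x ∧ allB p xs

isSSYT : List (List ℕ) → Bool
isSSYT tab = allB weakInc tab ∧ columnsOK tab

count : ℕ → List ℕ → ℕ
count v []       = 0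
count v (a ∷ as) = (if v ≡ᵇ a then 1 else 0) + count v as

maxL : List ℕ → ℕ
maxL = foldr _⊔_ 0

sameContent : List ℕ → List (List ℕ) → Bool
sameContent α tab = allB (λ v → count v (concat tab) ≡ᵇ count v α) (map suc (upTo (maxL α)))

schurCoeff : List ℕ → List ℕ → ℕ
schurCoeff λ′ α =
  length (filterᵇ (λ tab → isSSYT tab ∧ sameContent α tab) (fillings λ′ (maxL α)))

SchurPositive : ℕ → (List ℕ → ℕ) → Set
SchurPositive d f =
  Σ (List (List ℕ)) λ Λ → All (IsPartition d) Λ ×
    (∀ α → IsMonomial d α → f α ≡ sum (map (λ μ → schurCoeff μ α) Λ))

record SCG (n : ℕ) : Set₁ where
  field
    V    : Set
    edge : ℕ → V → V → Set
    sig  : V → ℕ → Sign           -- sig v i = σ(v)_i, i ∈ [n-1]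

module _ {n : ℕ} (G : SCG n) where
  open SCG G

  ResStep : ℕ → ℕ → V → V → Set
  ResStep i j u v = Σ ℕ λ s → (i + 1 ≤ s × s ≤ j ∸ 1) × (edge s u v ⊎ edge s v u)

  resSig : ℕ → V → ℕ → Sign
  resSig i v s = sig v (s + i ∸ 1)

  IsComponent : ℕ → ℕ → V → List V → Set
  IsComponent i j w L =
    Unique L × (∀ v → (v ∈ L → Star (ResStep i j) w v) × (Star (ResStep i j) w v → v ∈ L))

  compGF : ℕ → List V → List ℕ → ℕ
  compGF i L α = sum (map (λ v → qCoeff (resSig i v) α) L)

  LSP : ℕ → Set
  LSP d = ∀ i j → 1 ≤ i → j ≤ n → j + 1 ≡ i + d →
          ∀ w L → IsComponent i j w L → SchurPositive d (compGF i L)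

  Axiom0 : Set
  Axiom0 = ∀ i w x y → edge i w x → edge i w y → x ≡ y

  Axiom1 : Set
  Axiom1 = Axiom0 × (∀ i → 2 ≤ i → i ≤ n ∸ 1 → ∀ w →
             ((Σ V λ x → edge i w x) → sig w (i ∸ 1) ≡ neg (sig w i)) ×
             (sig w (i ∸ 1) ≡ neg (sig w i) → Σ V λ x → edge i w x))

  Axiom2 : Set
  Axiom2 = ∀ i w x → edge i w x →
             sig w (i ∸ 1) ≡ neg (sig x (i ∸ 1)) × sig w i ≡ neg (sig x i) ×
             (∀ h → 1 ≤ h → h ≤ n ∸ 1 → (h + 2 < i ⊎ i + 1 < h) → sig w h ≡ sig x h)

  Axiom3 : Set
  Axiom3 = ∀ i w x → edge i w x →
             (3 ≤ i → sig w (i ∸ 2) ≡ neg (sig x (i ∸ 2)) → sig w (i ∸ 2) ≡ neg (sig w (i ∸ 1))) ×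
             (i + 1 ≤ n ∸ 1 → sig w (i + 1) ≡ neg (sig x (i + 1)) → sig w (i + 1) ≡ neg (sig w i))

  Axiom4a : Set
  Axiom4a = ∀ i → 4 ≤ i → i ≤ n ∸ 1 → ∀ w v → edge (i ∸ 1) w v → ¬ edge i w v →
              sig w (i ∸ 3) ≢ sig v (i ∸ 3) → sig w i ≢ sig v i →
              ∀ L₁ L₂ → IsComponent (i ∸ 3) i w L₁ → IsComponent (i ∸ 2) (i + 1) w L₂ →
              ∀ α → IsMonomial 4 α → compGF (i ∸ 3) L₁ α ≡ compGF (i ∸ 2) L₂ α

  TypeW : ℕ → V → Set
  TypeW i v = (Σ V λ a → edge i v a) × (Σ V λ b → edge (i ∸ 1) v b × sig v i ≡ neg (sig b i))

  EE : ℕ → ℕ → V → V → Set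
  EE i zero    x y = x ≡ y
  EE i (suc m) x y = Σ V λ z → Σ V λ z′ → EE i m x z × edge (i ∸ 2) z z′ × edge (i ∸ 1) z′ y

  FlatChain : ℕ → ℕ → (ℕ → V) → Set
  FlatChain i h x =
    1 ≤ h ×
    (∀ p q → 1 ≤ p → p ≤ 2 * h → 1 ≤ q → q ≤ 2 * h → x p ≡ x q → p ≡ q) ×
    (∀ p → 1 ≤ p → p ≤ 2 * h → Σ V λ y → edge (i ∸ 2) (x p) y) ×
    (∀ j → 1 ≤ j → j ≤ h → edge i (x (2 * j)) (x (2 * j ∸ 1))) ×
    (∀ j → 1 ≤ j → j < h → Σ ℕ λ m → Σ V λ y →
       EE i m (x (2 * j)) y × ¬ TypeW (i ∸ 1) y × edge (i ∸ 2) y (x (2 * j + 1)))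

  Axiom4b : Set
  Axiom4b = ∀ i → 4 ≤ i → i < n → ∀ h x → FlatChain i h x →
              ∀ j → 2 < j → j < 2 * h ∸ 1 → TypeW (i + 1) (x j) →
              (∀ k → 1 ≤ k → k ≤ j → TypeW (i + 1) (x k)) ⊎
              (∀ k → j ≤ k → k ≤ 2 * h → TypeW (i + 1) (x k))

  Axiom5 : Set
  Axiom5 = ∀ i j w x y → edge i w x → edge j x y → (i + 3 ≤ j ⊎ j + 3 ≤ i) →
             Σ V λ v → edge j w v × edge i v y

  IsDGraph : Set
  IsDGraph = Axiom1 × Axiom2 × Axiom3 × Axiom4a × Axiom4b × Axiom5 × LSP 4 × LSP 5

Word : Set
Word = List ℕ

IsWord : ℕ → ℕ → Word → Set
IsWord N n u = length u ≡ n × All (λ a → 1 ≤ a × a ≤ N) u × Unique u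

bac bca acb cab : ℕ → ℕ → ℕ → Word → Word → Word
bac a b c v w = v ++ (b ∷ a ∷ c ∷ w)
bca a b c v w = v ++ (b ∷ c ∷ a ∷ w)
acb a b c v w = v ++ (a ∷ c ∷ b ∷ w)
cab a b c v w = v ++ (c ∷ a ∷ b ∷ w)

SamePair : Word → Word → Word → Word → Set
SamePair u x p q = (u ≡ p × x ≡ q) ⊎ (u ≡ q × x ≡ p)

AllowedEdge : ℕ → ℕ → ℕ → Word → Word → Word → Word → Set
AllowedEdge a b c v w u x =
  SamePair u x (bac a b c v w) (bca a b c v w) ⊎
  SamePair u x (acb a b c v w) (cab a b c v w) ⊎
  SamePair u x (bac a b c v w) (acb a b c v w) ⊎
  SamePair u x (bca a b c v w) (cab a b c v w)

InFour : ℕ → ℕ → ℕ → Word → Word → Word → Set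
InFour a b c v w u =
  u ≡ bac a b c v w ⊎ u ≡ bca a b c v w ⊎ u ≡ acb a b c v w ⊎ u ≡ cab a b c v w

record D0Graph (N n : ℕ) : Set₁ where
  field
    W       : Word → Bool
    W⊆      : ∀ u → T (W u) → IsWord N n u
    E       : ℕ → Word → Word → Set
    E-sym   : ∀ {i u x} → E i u x → E i x u
    E-vert  : ∀ {i u x} → E i u x → T (W u) × T (W x)
    E-col   : ∀ {i u x} → E i u x → 2 ≤ i × i ≤ n ∸ 1
    E-shape : ∀ {i u x} → E i u x →
                Σ ℕ λ a → Σ ℕ λ b → Σ ℕ λ c → Σ Word λ v → Σ Word λ w →
                  a < b × b < c × length v ≡ i ∸ 2 × AllowedEdge a b c v w u x
    E-exact : ∀ i → 2 ≤ i → i ≤ n ∸ 1 → ∀ a b c v w → a < b → b < c → length v ≡ i ∸ 2 →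
                ∀ u → InFour a b c v w u → T (W u) →
                  (Σ Word λ x → E i u x) × (∀ x y → E i u x → E i u y → x ≡ y)

nth : Word → ℕ → ℕ
nth []       k       = 0
nth (a ∷ u)  zero    = a
nth (a ∷ u)  (suc k) = nth u k

-- σ(u)_i = +1 iff u_i < u_{i+1}  (1-based positions)
wordSig : Word → ℕ → Sign
wordSig u i = if nth u (i ∸ 1) <ᵇ nth u i then plus else minus

toSCG : ∀ {N n} → D0Graph N n → SCG n
toSCG D = record
  { V    = Σ Word (λ u → T (D0Graph.W D u))
  ; edge = λ i u x → D0Graph.E D i (Data.Product.proj₁ u) (Data.Product.proj₁ x)
  ; sig  = λ u → wordSig (Data.Product.proj₁ u)
  }

{-# OPTIONS --safe #-}
module Submission where

-- Enumerating the graphs is hopeless: when `W` is all of S_5 there are 60 blocks with two perfect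
-- matchings each. A certificate avoids this by fixing the shapes attached to a permutation
-- independently of the matchings. Two obstacles shape the rest. First, coefficients live in ℕ, so
-- no term carries a sign: what should be subtracted at a vertex is added on the other side of the
-- identity, and exchanging the ends of all `i`-edges turns the total on one side into the total on
-- the other. Secondly, Schur positivity speaks of infinitely many monomials. Coefficients of Q_S
-- and of Schur functions are both invariant under increasing relabellings of the variables, so
-- 2^(d-1) monomials suffice and `verify` is a finite Boolean computation. Standardisation does the
-- same for words: a window of `d` letters matters only through its relative order.

-- The i-edges allowed on the arrangements of a < b < c in positions i − 1, i, i + 1 are
-- exactly the pairs joining {acb, bca} to {bac, cab}, and inside W they form a perfect
-- matching.  So in the sum over a component of Res_K any terms cancel which, for some
-- i, depend on a word only through its block of four arrangements, up to a sign that differs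
-- between the two sides.  LSP_d thereby reduces to an identity on S_d, checked by computation:
-- Q_{Des π} is, modulo such alternating terms, the sum of a multiset of Schur functions
-- attached to π.  Schur positivity of the component follows by adding up over its vertices.
--
-- For axiom 4′a the hypotheses force the five letters concerned to be p b a c q and
-- p a c b q with a < p < b < q < c, or the same with the order reversed.  Whatever the
-- other edges are, the two components are then paths on five vertices with the
-- same list of signatures.

open import Defs
open import Data.Bool using (Bool; true; false; T; _∧_; not; if_then_else_)
open import Data.Bool.Properties using (∧-zeroʳ; T-irrelevant)
open import Data.Empty using (⊥)
open import Data.List
  using (List; []; _∷_; _++_; length; map; concatMap; concat; filterᵇ; upTo; foldl; take; drop; _∷ʳ_)
open import Data.List.Properties
  using (∷-injective; ++-cancelˡ; length-map; ++-identityʳ; map-++; map-∘; map-cong; map-cong-local; upTo-∷ʳ; concat-map; length-++; ++-assoc)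
open import Data.List.Membership.Propositional using (_∈_; lose)
open import Data.List.Membership.Propositional.Properties
  using (∈-map⁺; ∈-map⁻; ∈-upTo⁺; ∈-upTo⁻; ∈-++⁺ˡ; ∈-++⁺ʳ; ∈-concatMap⁺)
open import Data.List.Membership.Propositional.Properties.WithK using (unique∧set⇒bag)
open import Data.List.Relation.Binary.BagAndSetEquality using (∼bag⇒↭)
open import Data.List.Relation.Binary.Permutation.Propositional using (_↭_; ↭-trans; ↭-refl; prep; swap)
import Data.List.Relation.Binary.Permutation.Propositional.Properties as Perm
open import Data.List.Relation.Unary.All as All using (All; []; _∷_)
import Data.List.Relation.Unary.All.Properties as Allₚ
open import Data.List.Relation.Unary.Any as Any using (Any; here; there)
import Data.List.Relation.Unary.Any.Properties as Anyₚ
open import Data.List.Relation.Unary.Linked as Linked using (Linked; _∷_)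
open import Data.List.Relation.Unary.AllPairs using ([]; _∷_)
open import Data.List.Relation.Unary.Unique.Propositional using (Unique)
import Data.List.Relation.Unary.Unique.Propositional.Properties as Unique
open import Data.Nat
open import Data.Nat.ListAction using (sum)
open import Data.Nat.ListAction.Properties using (sum-++; sum-↭)
open import Data.Nat.Properties
open import Data.Product using (Σ; ∃; _×_; _,_; proj₁; proj₂)
open import Data.Sum using (_⊎_; inj₁; inj₂)
open import Data.Unit using (tt)
open import Function using (id; _∘_; mk⇔)
open import Relation.Binary.Construct.Closure.ReflexiveTransitive using (Star; _◅_; _◅◅_) renaming (ε to done)
open import Relation.Binary.Definitions using (tri<; tri≈; tri>)
open import Relation.Binary.PropositionalEquality
open import Relation.Nullary using (¬_; Dec; yes; no; contradiction)
open import Relation.Nullary.Decidable using (toWitness; _×-dec_)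

-- Finite sums and Boolean tests

private variable
  A B : Set

∑ : List A → (A → ℕ) → ℕ
∑ xs f = sum (map f xs)

∑-cong : ∀ (xs : List A) {f g : A → ℕ} → (∀ x → f x ≡ g x) → ∑ xs f ≡ ∑ xs g
∑-cong xs eq = cong sum (map-cong eq xs)

∑-zero : ∀ (xs : List A) {f : A → ℕ} → (∀ x → f x ≡ 0) → ∑ xs f ≡ 0
∑-zero []       eq = refl
∑-zero (x ∷ xs) eq = cong₂ _+_ (eq x) (∑-zero xs eq)

∑-++ : ∀ (xs : List A) {ys} {f : A → ℕ} → ∑ (xs ++ ys) f ≡ ∑ xs f + ∑ ys f
∑-++ xs {ys} {f} = trans (cong sum (map-++ f xs ys)) (sum-++ (map f xs) (map f ys))

∑-map : ∀ (g : A → B) (xs : List A) {f : B → ℕ} → ∑ (map g xs) f ≡ ∑ xs (f ∘ g)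
∑-map g xs = cong sum (sym (map-∘ xs))

∑-concatMap : ∀ (g : A → List B) (xs : List A) {f : B → ℕ} →
              ∑ (concatMap g xs) f ≡ ∑ xs (λ x → ∑ (g x) f)
∑-concatMap g []       = refl
∑-concatMap g (x ∷ xs) = trans (∑-++ (g x)) (cong (∑ (g x) _ +_) (∑-concatMap g xs))

∑-+ : ∀ (xs : List A) {f g : A → ℕ} → ∑ xs (λ x → f x + g x) ≡ ∑ xs f + ∑ xs g
∑-+ []       = refl
∑-+ (x ∷ xs) {f} {g} = begin
  f x + g x + ∑ xs (λ x → f x + g x) ≡⟨ cong (f x + g x +_) (∑-+ xs) ⟩
  f x + g x + (∑ xs f + ∑ xs g)      ≡⟨ +-assoc (f x) (g x) _ ⟩
  f x + (g x + (∑ xs f + ∑ xs g))    ≡⟨ cong (f x +_) (+-comm (g x) _) ⟩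
  f x + (∑ xs f + ∑ xs g + g x)      ≡⟨ cong (f x +_) (+-assoc (∑ xs f) _ _) ⟩
  f x + (∑ xs f + (∑ xs g + g x))    ≡⟨ cong (λ k → f x + (∑ xs f + k)) (+-comm (∑ xs g) (g x)) ⟩
  f x + (∑ xs f + (g x + ∑ xs g))    ≡⟨ +-assoc (f x) _ _ ⟨
  f x + ∑ xs f + (g x + ∑ xs g)      ∎
  where open ≡-Reasoning

∑-swap : ∀ (xs : List A) (ys : List B) {f : A → B → ℕ} →
         ∑ xs (λ x → ∑ ys (f x)) ≡ ∑ ys (λ y → ∑ xs (λ x → f x y))
∑-swap []       ys     = sym (∑-zero ys (λ _ → refl))
∑-swap (x ∷ xs) ys {f} = trans (cong (∑ ys (f x) +_) (∑-swap xs ys)) (sym (∑-+ ys))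

∑-↭ : ∀ {xs ys : List A} {f : A → ℕ} → xs ↭ ys → ∑ xs f ≡ ∑ ys f
∑-↭ {f = f} p = sum-↭ (Perm.map⁺ f p)

-- Since `ι` is injective and preserves `xs`, the list `map ι xs` is duplicate-free with the same
-- members as `xs`, hence a rearrangement of it. Later `ι` exchanges the ends of the edges of one
-- colour.
∑-involution : ∀ (ι : A → A) (xs : List A) → Unique xs → (∀ x → ι (ι x) ≡ x) →
               (∀ {x} → x ∈ xs → ι x ∈ xs) → ∀ {f : A → ℕ} → ∑ xs (f ∘ ι) ≡ ∑ xs f
∑-involution ι xs uniq inv closed = trans (sym (∑-map ι xs)) (∑-↭ (∼bag⇒↭
  (unique∧set⇒bag (Unique.map⁺ injective uniq) uniq
    (mk⇔ (λ y∈ → let (x , x∈ , eq) = ∈-map⁻ ι y∈ in subst (_∈ xs) (sym eq) (closed x∈))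
         (λ y∈ → subst (_∈ map ι xs) (inv _) (∈-map⁺ ι (closed y∈)))))))
  where
  injective : ∀ {x y} → ι x ≡ ι y → x ≡ y
  injective {x} {y} eq = trans (sym (inv x)) (trans (cong ι eq) (inv y))

<ᵇ-true : ∀ {a b} → a < b → (a <ᵇ b) ≡ true
<ᵇ-true {a} {b} a<b with a <ᵇ b | <⇒<ᵇ a<b
... | true | _ = refl

<ᵇ-false : ∀ {a b} → b ≤ a → (a <ᵇ b) ≡ false
<ᵇ-false {a} {b} b≤a with a <ᵇ b in eq
... | false = refl
... | true  = contradiction (<ᵇ⇒< a b (subst T (sym eq) tt)) (≤⇒≯ b≤a)

≡ᵇ-true : ∀ a → (a ≡ᵇ a) ≡ true
≡ᵇ-true zero    = refl
≡ᵇ-true (suc a) = ≡ᵇ-true a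

≡ᵇ-false : ∀ {a b} → a ≢ b → (a ≡ᵇ b) ≡ false
≡ᵇ-false {a} {b} a≢b with a ≡ᵇ b in eq
... | false = refl
... | true  = contradiction (≡ᵇ⇒≡ a b (subst T (sym eq) tt)) a≢b

indicator : Bool → ℕ
indicator b = if b then 1 else 0

length-filterᵇ : ∀ (p : A → Bool) xs → length (filterᵇ p xs) ≡ ∑ xs (indicator ∘ p)
length-filterᵇ p []       = refl
length-filterᵇ p (x ∷ xs) with p x
... | true  = cong suc (length-filterᵇ p xs)
... | false = length-filterᵇ p xs

-- Turns a universal test into the vanishing of a sum, so that the summation lemma `∑-range-φ` also
-- applies to the test inside `sameContent`.
allB-∑ : ∀ (p : A → Bool) xs → allB p xs ≡ (∑ xs (indicator ∘ not ∘ p) ≡ᵇ 0)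
allB-∑ p []       = refl
allB-∑ p (x ∷ xs) with p x
... | true  = allB-∑ p xs
... | false = refl

allB-false : ∀ (p : A → Bool) {x xs} → x ∈ xs → p x ≡ false → allB p xs ≡ false
allB-false p {xs = _ ∷ xs} (here refl) eq = cong (_∧ allB p xs) eq
allB-false p {xs = x ∷ _}  (there x∈)  eq = trans (cong (p x ∧_) (allB-false p x∈ eq)) (∧-zeroʳ (p x))

allB-true : ∀ (p : A → Bool) {x xs} → allB p xs ≡ true → x ∈ xs → p x ≡ true
allB-true p {x} eq x∈ with p x in px
... | true  = refl
... | false = contradiction (trans (sym eq) (allB-false p x∈ px)) (λ ())

-- Schur coefficients only see the relative order of the entries of a monomial

range : ℕ → List ℕ
range M = map suc (upTo M)

∑-range-suc : ∀ M {f : ℕ → ℕ} → ∑ (range (suc M)) f ≡ ∑ (range M) f + f (suc M)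
∑-range-suc M {f} = begin
  ∑ (range (suc M)) f                ≡⟨ cong (λ l → ∑ (map suc l) f) (upTo-∷ʳ M) ⟨
  ∑ (map suc (upTo M ∷ʳ M)) f        ≡⟨ ∑-map suc (upTo M ∷ʳ M) ⟩
  ∑ (upTo M ∷ʳ M) (f ∘ suc)          ≡⟨ ∑-++ (upTo M) ⟩
  ∑ (upTo M) (f ∘ suc) + (f (suc M) + 0) ≡⟨ cong₂ _+_ (sym (∑-map suc (upTo M))) (+-identityʳ _) ⟩
  ∑ (range M) f + f (suc M)          ∎
  where open ≡-Reasoning

∑-range-gap : ∀ M g {f : ℕ → ℕ} → (∀ v → M < v → v ≤ M + g → f v ≡ 0) →
              ∑ (range (M + g)) f ≡ ∑ (range M) f
∑-range-gap M zero    vanish = cong (λ k → ∑ (range k) _) (+-identityʳ M)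
∑-range-gap M (suc g) {f} vanish = begin
  ∑ (range (M + suc g)) f               ≡⟨ cong (λ k → ∑ (range k) f) (+-suc M g) ⟩
  ∑ (range (suc (M + g))) f             ≡⟨ ∑-range-suc (M + g) ⟩
  ∑ (range (M + g)) f + f (suc (M + g)) ≡⟨ cong₂ _+_ (∑-range-gap M g (λ v lo hi → vanish v lo (≤-trans hi (+-monoʳ-≤ M (n≤1+n g)))))
                                              (vanish _ (s≤s (m≤m+n M g)) (≤-reflexive (sym (+-suc M g)))) ⟩
  ∑ (range M) f + 0                     ≡⟨ +-identityʳ _ ⟩
  ∑ (range M) f                         ∎
  where open ≡-Reasoning

count-∈ : ∀ {v xs} → v ∈ xs → (count v xs ≡ᵇ 0) ≡ false
count-∈ {v} (here refl) rewrite ≡ᵇ-true v = refl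
count-∈ {v} {x ∷ _} (there v∈) with v ≡ᵇ x
... | true  = refl
... | false = count-∈ v∈

-- The image of `φ` may have gaps; the sums below show that fillings using a missed value contribute
-- nothing. The condition `φ 0 ≡ 0` lets `φ` commute with `maxL`, whose value on the empty list is
-- 0.
module Relabelling (φ : ℕ → ℕ) (φ0 : φ 0 ≡ 0) (φ-step : ∀ k → φ k < φ (suc k)) where

  φ-mono-≤ : ∀ {a b} → a ≤ b → φ a ≤ φ b
  φ-mono-≤ a≤b = go (≤⇒≤′ a≤b)
    where
    go : ∀ {a b} → a ≤′ b → φ a ≤ φ b
    go ≤′-refl       = ≤-refl
    go (≤′-step a≤b) = ≤-trans (go a≤b) (<⇒≤ (φ-step _))

  φ-mono-< : ∀ {a b} → a < b → φ a < φ b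
  φ-mono-< {a} a<b = <-≤-trans (φ-step a) (φ-mono-≤ a<b)

  φ-injective : ∀ {a b} → φ a ≡ φ b → a ≡ b
  φ-injective {a} {b} eq with <-cmp a b
  ... | tri< a<b _ _ = contradiction eq (<⇒≢ (φ-mono-< a<b))
  ... | tri≈ _ a≡b _ = a≡b
  ... | tri> _ _ b<a = contradiction (sym eq) (<⇒≢ (φ-mono-< b<a))

  φ-<ᵇ : ∀ a b → (φ a <ᵇ φ b) ≡ (a <ᵇ b)
  φ-<ᵇ a b with a <? b
  ... | yes a<b = trans (<ᵇ-true (φ-mono-< a<b)) (sym (<ᵇ-true a<b))
  ... | no  a≮b = trans (<ᵇ-false (φ-mono-≤ (≮⇒≥ a≮b))) (sym (<ᵇ-false (≮⇒≥ a≮b)))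

  φ-≤ᵇ : ∀ a b → (φ a <ᵇ suc (φ b)) ≡ (a <ᵇ suc b)
  φ-≤ᵇ a b with a ≤? b
  ... | yes a≤b = trans (<ᵇ-true (s≤s (φ-mono-≤ a≤b))) (sym (<ᵇ-true (s≤s a≤b)))
  ... | no  a≰b = trans (<ᵇ-false (φ-mono-< (≰⇒> a≰b))) (sym (<ᵇ-false (≰⇒> a≰b)))

  φ-≡ᵇ : ∀ a b → (φ a ≡ᵇ φ b) ≡ (a ≡ᵇ b)
  φ-≡ᵇ a b with a ≟ b
  ... | yes refl = trans (≡ᵇ-true (φ a)) (sym (≡ᵇ-true a))
  ... | no  a≢b  = trans (≡ᵇ-false (a≢b ∘ φ-injective)) (sym (≡ᵇ-false a≢b))

  Missed : ℕ → ℕ → Set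
  Missed K v = 1 ≤ v × v ≤ φ K × (∀ k → φ k ≢ v)

  Missed-suc : ∀ {K v} → Missed K v → Missed (suc K) v
  Missed-suc {K} (1≤v , v≤ , off) = 1≤v , ≤-trans v≤ (<⇒≤ (φ-step K)) , off

  between-missed : ∀ {K v} → φ K < v → v < φ (suc K) → Missed (suc K) v
  between-missed {K} {v} lo hi = ≤-trans (s≤s z≤n) lo , <⇒≤ hi , off
    where
    off : ∀ k → φ k ≢ v
    off k refl with k ≤? K
    ... | yes k≤K = <⇒≱ lo (φ-mono-≤ k≤K)
    ... | no  k≰K = <⇒≱ hi (φ-mono-≤ (≰⇒> k≰K))

  ∑-range-φ : ∀ K {f : ℕ → ℕ} → (∀ v → Missed K v → f v ≡ 0) →
              ∑ (range (φ K)) f ≡ ∑ (range K) (f ∘ φ)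
  ∑-range-φ zero    {f} _ = cong (λ M → ∑ (range M) f) φ0
  ∑-range-φ (suc K) {f} vanish = begin
    ∑ (range (φ (suc K))) f              ≡⟨ cong (λ M → ∑ (range M) f) top ⟨
    ∑ (range (suc (φ K + g))) f          ≡⟨ ∑-range-suc (φ K + g) ⟩
    ∑ (range (φ K + g)) f + f (suc (φ K + g)) ≡⟨ cong₂ _+_ (∑-range-gap (φ K) g gap) (cong f top) ⟩
    ∑ (range (φ K)) f + f (φ (suc K))    ≡⟨ cong (_+ f (φ (suc K))) (∑-range-φ K (λ v → vanish v ∘ Missed-suc)) ⟩
    ∑ (range K) (f ∘ φ) + f (φ (suc K))  ≡⟨ ∑-range-suc K ⟨
    ∑ (range (suc K)) (f ∘ φ)            ∎
    where
    open ≡-Reasoning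
    g = φ (suc K) ∸ suc (φ K)
    top : suc (φ K + g) ≡ φ (suc K)
    top = m+[n∸m]≡n (φ-step K)
    gap : ∀ v → φ K < v → v ≤ φ K + g → f v ≡ 0
    gap v lo hi = vanish v (between-missed lo (≤-trans (s≤s hi) (≤-reflexive top)))

  ∑-allLists-φ : ∀ K k {f : List ℕ → ℕ} → (∀ l → Any (Missed K) l → f l ≡ 0) →
                 ∑ (allLists k (φ K)) f ≡ ∑ (allLists k K) (f ∘ map φ)
  ∑-allLists-φ K zero    vanish = refl
  ∑-allLists-φ K (suc k) {f} vanish = begin
    ∑ (allLists (suc k) (φ K)) f
      ≡⟨ ∑-concatMap _ (range (φ K)) ⟩
    ∑ (range (φ K)) (λ a → ∑ (map (a ∷_) (allLists k (φ K))) f)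
      ≡⟨ ∑-cong (range (φ K)) (λ a → ∑-map (a ∷_) (allLists k (φ K))) ⟩
    ∑ (range (φ K)) (λ a → ∑ (allLists k (φ K)) (f ∘ (a ∷_)))
      ≡⟨ ∑-range-φ K (λ v missed → ∑-zero (allLists k (φ K)) (λ l → vanish _ (here missed))) ⟩
    ∑ (range K) (λ a → ∑ (allLists k (φ K)) (f ∘ (φ a ∷_)))
      ≡⟨ ∑-cong (range K) (λ a → ∑-allLists-φ K k (λ l → vanish _ ∘ there)) ⟩
    ∑ (range K) (λ a → ∑ (allLists k K) (f ∘ map φ ∘ (a ∷_)))
      ≡⟨ ∑-cong (range K) (λ a → ∑-map (a ∷_) (allLists k K)) ⟨
    ∑ (range K) (λ a → ∑ (map (a ∷_) (allLists k K)) (f ∘ map φ))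
      ≡⟨ ∑-concatMap _ (range K) ⟨
    ∑ (allLists (suc k) K) (f ∘ map φ) ∎
    where open ≡-Reasoning

  ∑-fillings-φ : ∀ K μ {f : List (List ℕ) → ℕ} → (∀ t → Any (Any (Missed K)) t → f t ≡ 0) →
                 ∑ (fillings μ (φ K)) f ≡ ∑ (fillings μ K) (f ∘ map (map φ))
  ∑-fillings-φ K []      vanish = refl
  ∑-fillings-φ K (r ∷ μ) {f} vanish = begin
    ∑ (fillings (r ∷ μ) (φ K)) f
      ≡⟨ ∑-concatMap _ (allLists r (φ K)) ⟩
    ∑ (allLists r (φ K)) (λ a → ∑ (map (a ∷_) (fillings μ (φ K))) f)
      ≡⟨ ∑-cong (allLists r (φ K)) (λ a → ∑-map (a ∷_) (fillings μ (φ K))) ⟩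
    ∑ (allLists r (φ K)) (λ a → ∑ (fillings μ (φ K)) (f ∘ (a ∷_)))
      ≡⟨ ∑-allLists-φ K r (λ l missed → ∑-zero (fillings μ (φ K)) (λ t → vanish _ (here missed))) ⟩
    ∑ (allLists r K) (λ a → ∑ (fillings μ (φ K)) (f ∘ (map φ a ∷_)))
      ≡⟨ ∑-cong (allLists r K) (λ a → ∑-fillings-φ K μ (λ t → vanish _ ∘ there)) ⟩
    ∑ (allLists r K) (λ a → ∑ (fillings μ K) (f ∘ map (map φ) ∘ (a ∷_)))
      ≡⟨ ∑-cong (allLists r K) (λ a → ∑-map (a ∷_) (fillings μ K)) ⟨
    ∑ (allLists r K) (λ a → ∑ (map (a ∷_) (fillings μ K)) (f ∘ map (map φ)))
      ≡⟨ ∑-concatMap _ (allLists r K) ⟨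
    ∑ (fillings (r ∷ μ) K) (f ∘ map (map φ)) ∎
    where open ≡-Reasoning

  weakInc-φ : ∀ r → weakInc (map φ r) ≡ weakInc r
  weakInc-φ []          = refl
  weakInc-φ (a ∷ [])    = refl
  weakInc-φ (a ∷ b ∷ r) = cong₂ _∧_ (φ-≤ᵇ a b) (weakInc-φ (b ∷ r))

  strictBelow-φ : ∀ r₁ r₂ → strictBelow (map φ r₁) (map φ r₂) ≡ strictBelow r₁ r₂
  strictBelow-φ (a ∷ r₁) (b ∷ r₂) = cong₂ _∧_ (φ-<ᵇ a b) (strictBelow-φ r₁ r₂)
  strictBelow-φ []       (b ∷ r₂) = refl
  strictBelow-φ []       []       = refl
  strictBelow-φ (a ∷ r₁) []       = refl

  isSSYT-φ : ∀ t → isSSYT (map (map φ) t) ≡ isSSYT t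
  isSSYT-φ t = cong₂ _∧_ (rows t) (columns t)
    where
    rows : ∀ t → allB weakInc (map (map φ) t) ≡ allB weakInc t
    rows []      = refl
    rows (r ∷ t) = cong₂ _∧_ (weakInc-φ r) (rows t)
    columns : ∀ t → columnsOK (map (map φ) t) ≡ columnsOK t
    columns []            = refl
    columns (r ∷ [])      = refl
    columns (r₁ ∷ r₂ ∷ t) = cong₂ _∧_ (strictBelow-φ r₁ r₂) (columns (r₂ ∷ t))

  maxL-φ : ∀ β → maxL (map φ β) ≡ φ (maxL β)
  maxL-φ []      = sym φ0
  maxL-φ (b ∷ β) = trans (cong (φ b ⊔_) (maxL-φ β)) (sym (mono-≤-distrib-⊔ φ-mono-≤ b (maxL β)))

  count-φ : ∀ k β → count (φ k) (map φ β) ≡ count k β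
  count-φ k []      = refl
  count-φ k (b ∷ β) = cong₂ (λ e c → (if e then 1 else 0) + c) (φ-≡ᵇ k b) (count-φ k β)

  count-missed : ∀ {v} → (∀ k → φ k ≢ v) → ∀ β → count v (map φ β) ≡ 0
  count-missed off []      = refl
  count-missed off (b ∷ β) rewrite ≡ᵇ-false (off b ∘ sym) = count-missed off β

  sameContent-φ : ∀ β t → sameContent (map φ β) (map (map φ) t) ≡ sameContent β t
  sameContent-φ β t = begin
    allB p (range (maxL (map φ β)))                    ≡⟨ cong (allB p ∘ range) (maxL-φ β) ⟩
    allB p (range (φ (maxL β)))                        ≡⟨ allB-∑ p (range (φ (maxL β))) ⟩
    (∑ (range (φ (maxL β))) (indicator ∘ not ∘ p) ≡ᵇ 0) ≡⟨ cong (_≡ᵇ 0) (∑-range-φ (maxL β) vanish) ⟩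
    (∑ (range (maxL β)) (indicator ∘ not ∘ p ∘ φ) ≡ᵇ 0) ≡⟨ cong (_≡ᵇ 0) (∑-cong (range (maxL β)) (cong (indicator ∘ not) ∘ p-φ)) ⟩
    (∑ (range (maxL β)) (indicator ∘ not ∘ q) ≡ᵇ 0)     ≡⟨ allB-∑ q (range (maxL β)) ⟨
    allB q (range (maxL β))                            ∎
    where
    open ≡-Reasoning
    p q : ℕ → Bool
    p v = count v (concat (map (map φ) t)) ≡ᵇ count v (map φ β)
    q k = count k (concat t) ≡ᵇ count k β
    p-φ : ∀ k → p (φ k) ≡ q k
    p-φ k = cong₂ _≡ᵇ_ (trans (cong (count (φ k)) (concat-map t)) (count-φ k (concat t))) (count-φ k β)
    vanish : ∀ v → Missed (maxL β) v → indicator (not (p v)) ≡ 0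
    vanish v (_ , _ , off) = cong (indicator ∘ not) (cong₂ _≡ᵇ_
      (trans (cong (count v) (concat-map t)) (count-missed off (concat t))) (count-missed off β))

  -- A missed entry is positive and at most `maxL (map φ β)`, so it is among the values that
  -- `sameContent` compares: its multiplicity is positive in `t` and zero in `map φ β`.
  sameContent-missed : ∀ β {t} → Any (Any (Missed (maxL β))) t → sameContent (map φ β) t ≡ false
  sameContent-missed β {t} missed with Any.satisfied (toMember (Anyₚ.concat⁺ missed))
    where
    toMember : ∀ {xs} → Any (Missed (maxL β)) xs → Any (λ v → v ∈ xs × Missed (maxL β) v) xs
    toMember (here px)  = here (here refl , px)
    toMember (there p)  = there (Any.map (λ (v∈ , m) → there v∈ , m) (toMember p))
  ... | suc v , v∈ , _ , v≤ , off = allB-false _ (∈-map⁺ suc (∈-upTo⁺ (subst (v <_) (sym (maxL-φ β)) v≤)))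
    (trans (cong (count (suc v) (concat t) ≡ᵇ_) (count-missed off β)) (count-∈ v∈))

  schurCoeff-φ : ∀ μ β → schurCoeff μ (map φ β) ≡ schurCoeff μ β
  schurCoeff-φ μ β = begin
    schurCoeff μ (map φ β)                      ≡⟨ length-filterᵇ p (fillings μ (maxL (map φ β))) ⟩
    ∑ (fillings μ (maxL (map φ β))) (indicator ∘ p) ≡⟨ cong (λ M → ∑ (fillings μ M) (indicator ∘ p)) (maxL-φ β) ⟩
    ∑ (fillings μ (φ (maxL β))) (indicator ∘ p) ≡⟨ ∑-fillings-φ (maxL β) μ (λ t missed → cong indicator
                                                     (trans (cong (isSSYT t ∧_) (sameContent-missed β missed)) (∧-zeroʳ (isSSYT t)))) ⟩
    ∑ (fillings μ (maxL β)) (indicator ∘ p ∘ map (map φ)) ≡⟨ ∑-cong (fillings μ (maxL β)) (λ t → cong indicator (cong₂ _∧_ (isSSYT-φ t) (sameContent-φ β t))) ⟩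
    ∑ (fillings μ (maxL β)) (indicator ∘ q)     ≡⟨ length-filterᵇ q (fillings μ (maxL β)) ⟨
    schurCoeff μ β                              ∎
    where
    open ≡-Reasoning
    p q : List (List ℕ) → Bool
    p t = isSSYT t ∧ sameContent (map φ β) t
    q t = isSSYT t ∧ sameContent β t

  qOK-φ : ∀ s j β → qOK s j (map φ β) ≡ qOK s j β
  qOK-φ s j []          = refl
  qOK-φ s j (a ∷ [])    = refl
  qOK-φ s j (a ∷ b ∷ β) = cong₂ (λ c d → (if isMinus (s j) then c else true) ∧ d) (φ-<ᵇ a b) (qOK-φ s (suc j) (b ∷ β))

  qCoeff-φ : ∀ s β → qCoeff s (map φ β) ≡ qCoeff s β
  qCoeff-φ s β = cong (λ b → if b then 1 else 0) (qOK-φ s 1 β)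

-- The weakly increasing words β with first letter b, length k + 1 and steps
-- 0 or 1: one for each relative order of a monomial.
patterns : ℕ → ℕ → List (List ℕ)
patterns b zero    = (b ∷ []) ∷ []
patterns b (suc k) = map (b ∷_) (patterns b k ++ patterns (suc b) k)

-- The fields `φ-below` and `b≤β` strengthen the induction: they allow its next step to redefine `φ`
-- at a single point. At `b = 1` the former yields `φ 0 ≡ 0`, as `Relabelling` requires.
record Normalised (b a : ℕ) (α : List ℕ) : Set where
  field
    φ       : ℕ → ℕ
    φ-step  : ∀ k → φ k < φ (suc k)
    φ-below : ∀ k → k < b → φ k ≡ k
    φ-at    : φ b ≡ a
    β       : List ℕ
    β∈      : β ∈ patterns b (length α)
    b≤β     : All (b ≤_) β
    map-φ   : map φ β ≡ a ∷ α

normalise : ∀ b a α → b ≤ a → Linked _≤_ (a ∷ α) → Normalised b a α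
normalise b a [] b≤a _ = record
  { φ = φ ; φ-step = step ; φ-below = λ k k<b → cong (if_then k else (k + (a ∸ b))) (<ᵇ-true k<b)
  ; φ-at = at ; β = b ∷ [] ; β∈ = here refl ; b≤β = ≤-refl ∷ [] ; map-φ = cong (_∷ []) at }
  where
  φ : ℕ → ℕ
  φ k = if k <ᵇ b then k else (k + (a ∸ b))
  at : φ b ≡ a
  at rewrite <ᵇ-false (≤-refl {b}) = m+[n∸m]≡n b≤a
  step : ∀ k → φ k < φ (suc k)
  step k with k <? b | suc k <? b
  ... | yes k<b | yes sk<b rewrite <ᵇ-true k<b | <ᵇ-true sk<b = ≤-refl
  ... | yes k<b | no  sk≮b rewrite <ᵇ-true k<b | <ᵇ-false (≮⇒≥ sk≮b) = s≤s (m≤m+n k _)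
  ... | no  k≮b | yes sk<b = contradiction (≤-trans (n≤1+n _) sk<b) k≮b
  ... | no  k≮b | no  sk≮b rewrite <ᵇ-false (≮⇒≥ k≮b) | <ᵇ-false (≮⇒≥ sk≮b) = ≤-refl
normalise b a (a′ ∷ α) b≤a (a≤a′ ∷ inc) with a ≟ a′
... | yes refl = record
  { φ = N.φ ; φ-step = N.φ-step ; φ-below = N.φ-below ; φ-at = N.φ-at ; β = b ∷ N.β
  ; β∈ = ∈-map⁺ (b ∷_) (∈-++⁺ˡ N.β∈) ; b≤β = ≤-refl ∷ N.b≤β ; map-φ = cong₂ _∷_ N.φ-at N.map-φ }
  where module N = Normalised (normalise b a α b≤a inc)
... | no a≢a′ = record
  { φ = φ ; φ-step = step ; φ-below = λ k k<b → trans (off (<⇒≢ k<b)) (N.φ-below k (≤-trans k<b (n≤1+n b)))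
  ; φ-at = at ; β = b ∷ N.β ; β∈ = ∈-map⁺ (b ∷_) (∈-++⁺ʳ (patterns b (length α)) N.β∈)
  ; b≤β = ≤-refl ∷ All.map (≤-trans (n≤1+n b)) N.b≤β
  ; map-φ = cong₂ _∷_ at (trans (map-cong-local (All.map (off ∘ >⇒≢) N.b≤β)) N.map-φ) }
  where
  a<a′ = ≤∧≢⇒< a≤a′ a≢a′
  module N = Normalised (normalise (suc b) a′ α (≤-trans (s≤s b≤a) a<a′) inc)
  -- Only the value at `b` is overridden. The map stays increasing because the number before `b` is
  -- fixed and `b ≤ a`, and because `suc b` goes to `a′ > a`. The letters of `N.β` are at least
  -- `suc b`, so their images do not change.
  φ : ℕ → ℕ
  φ k = if k ≡ᵇ b then a else N.φ k
  at : φ b ≡ a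
  at = cong (if_then a else N.φ b) (≡ᵇ-true b)
  off : ∀ {k} → k ≢ b → φ k ≡ N.φ k
  off {k} k≢b = cong (if_then a else N.φ k) (≡ᵇ-false k≢b)
  step : ∀ k → φ k < φ (suc k)
  step k with k ≟ b
  ... | yes refl = subst₂ _<_ (sym at) (sym (trans (off (>⇒≢ ≤-refl)) N.φ-at)) a<a′
  ... | no  k≢b with suc k ≟ b
  ...   | yes refl = subst₂ _<_ (sym (trans (off k≢b) (N.φ-below k (≤-trans ≤-refl (n≤1+n _))))) (sym at) b≤a
  ...   | no  sk≢b = subst₂ _<_ (sym (off k≢b)) (sym (off sk≢b)) (N.φ-step k)

normalForm : ∀ {d α} → IsMonomial (suc d) α →
             Σ (List ℕ) λ β → β ∈ patterns 1 d ×
               (∀ μ → schurCoeff μ α ≡ schurCoeff μ β) × (∀ s → qCoeff s α ≡ qCoeff s β)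
normalForm {α = a ∷ α} (refl , 1≤a ∷ _ , inc) = β , β∈ ,
  (λ μ → trans (cong (schurCoeff μ) (sym map-φ)) (schurCoeff-φ μ β)) ,
  (λ s → trans (cong (qCoeff s) (sym map-φ)) (qCoeff-φ s β))
  where
  open Normalised (normalise 1 a α 1≤a inc)
  open Relabelling φ (φ-below 0 (s≤s z≤n)) φ-step

-- Local structure of a D₀ graph

sgn : ℕ → ℕ → Sign
sgn x y = if x <ᵇ y then plus else minus

neg-involutive : ∀ s → neg (neg s) ≡ s
neg-involutive plus  = refl
neg-involutive minus = refl

neg-≢ : ∀ s → s ≢ neg s
neg-≢ plus  ()
neg-≢ minus ()

≢⇒neg : ∀ {s t} → s ≢ t → s ≡ neg t
≢⇒neg {plus}  {plus}  ne = contradiction refl ne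
≢⇒neg {plus}  {minus} ne = refl
≢⇒neg {minus} {plus}  ne = refl
≢⇒neg {minus} {minus} ne = contradiction refl ne

Sign-cases : ∀ s t → s ≡ t ⊎ s ≡ neg t
Sign-cases plus  plus  = inj₁ refl
Sign-cases plus  minus = inj₂ refl
Sign-cases minus plus  = inj₂ refl
Sign-cases minus minus = inj₁ refl

sgn-< : ∀ {x y} → x < y → sgn x y ≡ plus
sgn-< x<y = cong (if_then plus else minus) (<ᵇ-true x<y)

sgn-≥ : ∀ {x y} → y ≤ x → sgn x y ≡ minus
sgn-≥ y≤x = cong (if_then plus else minus) (<ᵇ-false y≤x)

sgn-> : ∀ {x y} → y < x → sgn x y ≡ minus
sgn-> = sgn-≥ ∘ <⇒≤

sgn-plus⁻ : ∀ {x y} → sgn x y ≡ plus → x < y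
sgn-plus⁻ {x} {y} eq with x <? y
... | yes x<y = x<y
... | no  x≮y = contradiction (trans (sym eq) (sgn-≥ (≮⇒≥ x≮y))) (λ ())

sgn-minus⁻ : ∀ {x y} → sgn x y ≡ minus → y ≤ x
sgn-minus⁻ {x} {y} eq with x <? y
... | yes x<y = contradiction (trans (sym eq) (sgn-< x<y)) (λ ())
... | no  x≮y = ≮⇒≥ x≮y

-- As `u < v` implies `x < y`, the two signs can differ in one way only. This is how a sign that
-- changes along an edge is turned into inequalities, for axioms 3 and 4′a.
sgn-mono : ∀ {x y u v} → (u < v → x < y) → sgn u v ≢ sgn x y → sgn u v ≡ minus × sgn x y ≡ plus
sgn-mono {x} {y} {u} {v} h ne with u <? v
... | yes u<v = contradiction (trans (sgn-< u<v) (sym (sgn-< (h u<v)))) ne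
... | no  u≮v = e , sym (trans (cong neg (sym e)) (sym (trans (≢⇒neg (ne ∘ sym)) refl)))
  where e = sgn-≥ (≮⇒≥ u≮v)

nth-++ : ∀ (v : Word) {xs} k → nth (v ++ xs) (length v + k) ≡ nth xs k
nth-++ []      k = refl
nth-++ (x ∷ v) k = nth-++ v k

nth-prefix : ∀ (v : Word) {xs ys k} → k < length v → nth (v ++ xs) k ≡ nth (v ++ ys) k
nth-prefix (x ∷ v) {k = zero}  _         = refl
nth-prefix (x ∷ v) {k = suc k} (s≤s k<) = nth-prefix v k<

wordSig-++ : ∀ (v : Word) {xs} s → wordSig (v ++ xs) (suc s + length v) ≡ wordSig xs (suc s)
wordSig-++ v {xs} s = cong₂ sgn
  (trans (cong (nth (v ++ xs)) (+-comm s (length v))) (nth-++ v s))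
  (trans (cong (nth (v ++ xs)) (+-comm (suc s) (length v))) (nth-++ v (suc s)))

-- The alternating arrangements of letters a, b, c in positions i − 1, i, i + 1.
-- For a < b < c the sign is σ_{i−1}.  No order is required of the letters, so that the
-- opposite order can be used as well.
data Triple (a b c : ℕ) : Sign → Word → Set where
  acb′ : Triple a b c plus  (a ∷ c ∷ b ∷ [])
  bca′ : Triple a b c plus  (b ∷ c ∷ a ∷ [])
  bac′ : Triple a b c minus (b ∷ a ∷ c ∷ [])
  cab′ : Triple a b c minus (c ∷ a ∷ b ∷ [])

Triple-reverse : ∀ {a b c s t} → Triple a b c s t → Triple c b a (neg s) t
Triple-reverse acb′ = cab′
Triple-reverse bca′ = bac′
Triple-reverse bac′ = bca′
Triple-reverse cab′ = acb′

Triple-length : ∀ {a b c s t} → Triple a b c s t → length t ≡ 3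
Triple-length acb′ = refl
Triple-length bca′ = refl
Triple-length bac′ = refl
Triple-length cab′ = refl

Triple-sig : ∀ {a b c s t} (w : Word) → a < b → b < c → Triple a b c s t →
             wordSig (t ++ w) 1 ≡ s × wordSig (t ++ w) 2 ≡ neg s
Triple-sig w a<b b<c acb′ = sgn-< (<-trans a<b b<c) , sgn-> b<c
Triple-sig w a<b b<c bca′ = sgn-< b<c , sgn-> (<-trans a<b b<c)
Triple-sig w a<b b<c bac′ = sgn-> a<b , sgn-< (<-trans a<b b<c)
Triple-sig w a<b b<c cab′ = sgn-> (<-trans a<b b<c) , sgn-< a<b

-- In an alternating triple the middle letter is the largest if the sign is `plus` and the smallest
-- if it is `minus`, so ordering the two outer letters sorts the triple.
sort3 : Sign → ℕ → ℕ → ℕ → List ℕ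
sort3 plus  x y z = x ⊓ z ∷ x ⊔ z ∷ y ∷ []
sort3 minus x y z = y ∷ x ⊓ z ∷ x ⊔ z ∷ []

Sorts : Sign → Word → List ℕ → Set
Sorts s (x ∷ y ∷ z ∷ []) l = sort3 s x y z ≡ l
Sorts s _                l = ⊥

Triple-sort : ∀ {a b c s t} → a < b → b < c → Triple a b c s t → Sorts s t (a ∷ b ∷ c ∷ [])
Triple-sort {a} {b} {c} a<b b<c acb′ = cong₂ (λ x y → x ∷ y ∷ c ∷ []) (m≤n⇒m⊓n≡m (<⇒≤ a<b)) (m≤n⇒m⊔n≡n (<⇒≤ a<b))
Triple-sort {a} {b} {c} a<b b<c bca′ = cong₂ (λ x y → x ∷ y ∷ c ∷ []) (m≥n⇒m⊓n≡n (<⇒≤ a<b)) (m≥n⇒m⊔n≡m (<⇒≤ a<b))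
Triple-sort {a} {b} {c} a<b b<c bac′ = cong₂ (λ x y → a ∷ x ∷ y ∷ []) (m≤n⇒m⊓n≡m (<⇒≤ b<c)) (m≤n⇒m⊔n≡n (<⇒≤ b<c))
Triple-sort {a} {b} {c} a<b b<c cab′ = cong₂ (λ x y → a ∷ x ∷ y ∷ []) (m≥n⇒m⊓n≡n (<⇒≤ b<c)) (m≥n⇒m⊔n≡m (<⇒≤ b<c))

Sorts-functional : ∀ {s t l l′} → Sorts s t l → Sorts s t l′ → l ≡ l′
Sorts-functional {t = x ∷ y ∷ z ∷ []} eq eq′ = trans (sym eq) eq′

Triple-unique : ∀ {a b c s t a′ b′ c′ s′} → a < b → b < c → a′ < b′ → b′ < c′ →
                Triple a b c s t → Triple a′ b′ c′ s′ t →
                s ≡ s′ × a ∷ b ∷ c ∷ [] ≡ a′ ∷ b′ ∷ c′ ∷ []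
Triple-unique a<b b<c a′<b′ b′<c′ T T′
  with trans (sym (proj₁ (Triple-sig [] a<b b<c T))) (proj₁ (Triple-sig [] a′<b′ b′<c′ T′))
... | refl = refl , Sorts-functional (Triple-sort a<b b<c T) (Triple-sort a′<b′ b′<c′ T′)

Triple-classify : ∀ {x y z} → x ≢ y → x ≢ z → y ≢ z → sgn x y ≡ neg (sgn y z) →
                  ∃ λ a → ∃ λ b → ∃ λ c → a < b × b < c × Triple a b c (sgn x y) (x ∷ y ∷ z ∷ [])
Triple-classify {x} {y} {z} x≢y x≢z y≢z alt with <-cmp x y | <-cmp y z | <-cmp x z
... | tri≈ _ eq _ | _ | _ = contradiction eq x≢y
... | _ | tri≈ _ eq _ | _ = contradiction eq y≢z
... | _ | _ | tri≈ _ eq _ = contradiction eq x≢z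
... | tri< x<y _ _ | tri< y<z _ _ | _ =
  contradiction (trans (sym (sgn-< x<y)) (trans alt (cong neg (sgn-< y<z)))) (λ ())
... | tri> _ _ x>y | tri> _ _ y>z | _ =
  contradiction (trans (sym (sgn-> x>y)) (trans alt (cong neg (sgn-> y>z)))) (λ ())
... | tri< x<y _ _ | tri> _ _ y>z | tri< x<z _ _ =
  x , z , y , x<z , y>z , subst (λ s → Triple x z y s (x ∷ y ∷ z ∷ [])) (sym (sgn-< x<y)) acb′
... | tri< x<y _ _ | tri> _ _ y>z | tri> _ _ x>z =
  z , x , y , x>z , x<y , subst (λ s → Triple z x y s (x ∷ y ∷ z ∷ [])) (sym (sgn-< x<y)) bca′
... | tri> _ _ x>y | tri< y<z _ _ | tri< x<z _ _ =
  y , x , z , x>y , x<z , subst (λ s → Triple y x z s (x ∷ y ∷ z ∷ [])) (sym (sgn-> x>y)) bac′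
... | tri> _ _ x>y | tri< y<z _ _ | tri> _ _ x>z =
  y , z , x , y<z , x>z , subst (λ s → Triple y z x s (x ∷ y ∷ z ∷ [])) (sym (sgn-> x>y)) cab′

++-split : ∀ (v v′ : Word) {x x′} → length v ≡ length v′ → v ++ x ≡ v′ ++ x′ → v ≡ v′ × x ≡ x′
++-split []      []       len eq   = refl , eq
++-split (a ∷ v) (b ∷ v′) len eq with ∷-injective eq
... | refl , eq′ with ++-split v v′ (suc-injective len) eq′
...   | refl , eq″ = refl , eq″

data EdgeView : ℕ → Word → Word → Set where
  view : ∀ {a b c s t t′} (v w : Word) → a < b → b < c → Triple a b c s t → Triple a b c (neg s) t′ →
         EdgeView (2 + length v) (v ++ t ++ w) (v ++ t′ ++ w)

module _ {N n : ℕ} (D : D0Graph N n) where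
  open D0Graph D

  private
    G = toSCG D
    open module G = SCG G using (V)

  edge-view : ∀ {i u x} → E i u x → EdgeView i u x
  edge-view {suc (suc i)} e with E-shape e | E-col e
  ... | a , b , c , v , w , a<b , b<c , refl , allowed | _ = go allowed
    where
    go : ∀ {u x} → AllowedEdge a b c v w u x → EdgeView (2 + length v) u x
    go (inj₁ (inj₁ (refl , refl)))               = view v w a<b b<c bac′ bca′
    go (inj₁ (inj₂ (refl , refl)))               = view v w a<b b<c bca′ bac′
    go (inj₂ (inj₁ (inj₁ (refl , refl))))        = view v w a<b b<c acb′ cab′
    go (inj₂ (inj₁ (inj₂ (refl , refl))))        = view v w a<b b<c cab′ acb′
    go (inj₂ (inj₂ (inj₁ (inj₁ (refl , refl))))) = view v w a<b b<c bac′ acb′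
    go (inj₂ (inj₂ (inj₁ (inj₂ (refl , refl))))) = view v w a<b b<c acb′ bac′
    go (inj₂ (inj₂ (inj₂ (inj₁ (refl , refl))))) = view v w a<b b<c bca′ cab′
    go (inj₂ (inj₂ (inj₂ (inj₂ (refl , refl))))) = view v w a<b b<c cab′ bca′
  edge-view {zero}  e with () ← proj₁ (E-col e)
  edge-view {suc zero} e with s≤s () ← proj₁ (E-col e)

  Triple⇒InFour : ∀ {a b c s t} v w → Triple a b c s t → InFour a b c v w (v ++ t ++ w)
  Triple⇒InFour v w acb′ = inj₂ (inj₂ (inj₁ refl))
  Triple⇒InFour v w bca′ = inj₂ (inj₁ refl)
  Triple⇒InFour v w bac′ = inj₁ refl
  Triple⇒InFour v w cab′ = inj₂ (inj₂ (inj₂ refl))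

  E-functional : ∀ {i u x y} → E i u x → E i u y → x ≡ y
  E-functional {x = x} {y} e e′ with edge-view e
  ... | view v w a<b b<c T T′ =
    proj₂ (E-exact _ (proj₁ (E-col e)) (proj₂ (E-col e)) _ _ _ v w a<b b<c refl _
             (Triple⇒InFour v w T) (proj₁ (E-vert e))) _ y e e′

  V-≡ : ∀ {x y : V} → proj₁ x ≡ proj₁ y → x ≡ y
  V-≡ {x , p} {_ , q} refl = cong (x ,_) (T-irrelevant p q)

  axiom0 : Axiom0 G
  axiom0 i w x y e e′ = V-≡ (E-functional e e′)

  -- The edge given by `E-exact` is seen through `edge-view`, which brings its own prefix, triple
  -- and letters. Lengths identify the prefix and the triple, and `Triple-unique` the letters, so
  -- the neighbour lies in the same block with the opposite sign.
  neighbour : ∀ {a b c s t u} v w → a < b → b < c → Triple a b c s t → u ≡ v ++ t ++ w →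
              2 + length v ≤ n ∸ 1 → T (W u) →
              Σ Word λ t′ → Triple a b c (neg s) t′ × E (2 + length v) u (v ++ t′ ++ w)
  neighbour {a} {b} {c} {s} {t} v w a<b b<c tr refl i≤ u∈
    with proj₁ (E-exact _ (s≤s (s≤s z≤n)) i≤ _ _ _ v w a<b b<c refl _ (Triple⇒InFour v w tr) u∈)
  ... | x , e = go refl refl e (edge-view e)
    where
    go : ∀ {i u x} → i ≡ 2 + length v → u ≡ v ++ t ++ w → E i u x → EdgeView i u x →
         Σ Word λ t′ → Triple a b c (neg s) t′ × E (2 + length v) (v ++ t ++ w) (v ++ t′ ++ w)
    go i≡ u≡ e (view {t = t₁} v′ w′ a′<b′ b′<c′ tr₁ tr₂)
      with ++-split v′ v (suc-injective (suc-injective i≡)) u≡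
    ... | refl , eq with ++-split t₁ t (trans (Triple-length tr₁) (sym (Triple-length tr))) eq
    ...   | refl , refl with Triple-unique a′<b′ b′<c′ a<b b<c tr₁ tr
    ...     | refl , refl = _ , tr₂ , e

  word-length : ∀ {u} → T (W u) → length u ≡ n
  word-length u∈ = proj₁ (W⊆ _ u∈)

  word-unique : ∀ {u} → T (W u) → Unique u
  word-unique u∈ = proj₂ (proj₂ (W⊆ _ u∈))

++-splitAt : ∀ k (u : Word) → k ≤ length u → ∃ λ v → ∃ λ w → u ≡ v ++ w × length v ≡ k
++-splitAt zero    u       _        = [] , u , refl , refl
++-splitAt (suc k) (x ∷ u) (s≤s k≤) with ++-splitAt k u k≤
... | v , w , refl , refl = x ∷ v , w , refl , refl

length-3 : ∀ (u : Word) → 3 ≤ length u → ∃ λ x → ∃ λ y → ∃ λ z → ∃ λ w → u ≡ x ∷ y ∷ z ∷ w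
length-3 (x ∷ y ∷ z ∷ w) (s≤s (s≤s (s≤s _))) = x , y , z , w , refl

Unique-++⁻ʳ : ∀ (v : List A) {w} → Unique (v ++ w) → Unique w
Unique-++⁻ʳ []      uniq       = uniq
Unique-++⁻ʳ (x ∷ v) (_ ∷ uniq) = Unique-++⁻ʳ v uniq

Unique-++⁻ˡ : ∀ (v : List A) {w} → Unique (v ++ w) → Unique v
Unique-++⁻ˡ []      uniq       = []
Unique-++⁻ˡ (x ∷ v) (x∉ ∷ uniq) = Allₚ.++⁻ˡ v x∉ ∷ Unique-++⁻ˡ v uniq

Triple-nth : ∀ {a b c s t} (w : Word) k → Triple a b c s t → nth (t ++ w) (3 + k) ≡ nth w k
Triple-nth w k acb′ = refl
Triple-nth w k bca′ = refl
Triple-nth w k bac′ = refl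
Triple-nth w k cab′ = refl

-- The outer letters are `a` and `b` on the `plus` side, `b` and `c` on the `minus` side. Hence
-- neither outer position decreases in passing from `plus` to `minus`, and its comparison with the
-- adjacent outside letter can flip in one direction only. This is the content of axiom 3.
Triple-first : ∀ {a b c t t′} w → a < b → b < c → Triple a b c plus t → Triple a b c minus t′ →
               nth (t ++ w) 0 ≤ nth (t′ ++ w) 0
Triple-first w a<b b<c acb′ bac′ = <⇒≤ a<b
Triple-first w a<b b<c acb′ cab′ = <⇒≤ (<-trans a<b b<c)
Triple-first w a<b b<c bca′ bac′ = ≤-refl
Triple-first w a<b b<c bca′ cab′ = <⇒≤ b<c

Triple-last : ∀ {a b c t t′} w → a < b → b < c → Triple a b c plus t → Triple a b c minus t′ →
              nth (t ++ w) 2 ≤ nth (t′ ++ w) 2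
Triple-last w a<b b<c acb′ bac′ = <⇒≤ b<c
Triple-last w a<b b<c acb′ cab′ = ≤-refl
Triple-last w a<b b<c bca′ bac′ = <⇒≤ (<-trans a<b b<c)
Triple-last w a<b b<c bca′ cab′ = <⇒≤ a<b

nth-++₀ : ∀ (v : Word) {xs} → nth (v ++ xs) (length v) ≡ nth xs 0
nth-++₀ v {xs} = trans (cong (nth (v ++ xs)) (sym (+-identityʳ (length v)))) (nth-++ v 0)

neg⇒≢ : ∀ {s t} → s ≡ neg t → s ≢ t
neg⇒≢ {t = t} eq eq′ = neg-≢ t (trans (sym eq′) eq)

-- Axioms 1, 2 and 3

module _ {N n : ℕ} (D : D0Graph N n) where
  open D0Graph D

  private
    G = toSCG D

  axiom1 : Axiom1 G
  axiom1 = axiom0 D , λ i 2≤i i≤ (u , u∈) → alternates i u , admits i 2≤i i≤ u u∈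
    where
    alternates : ∀ i u → (Σ (SCG.V G) λ x → E i u (proj₁ x)) → wordSig u (i ∸ 1) ≡ neg (wordSig u i)
    alternates i u (_ , e) with edge-view D e
    ... | view {s = s} {t} v w a<b b<c tr _ = begin
      wordSig (v ++ t ++ w) (1 + length v)       ≡⟨ wordSig-++ v 0 ⟩
      wordSig (t ++ w) 1                         ≡⟨ proj₁ (Triple-sig w a<b b<c tr) ⟩
      s                                          ≡⟨ neg-involutive s ⟨
      neg (neg s)                                ≡⟨ cong neg (proj₂ (Triple-sig w a<b b<c tr)) ⟨
      neg (wordSig (t ++ w) 2)                   ≡⟨ cong neg (wordSig-++ v 1) ⟨
      neg (wordSig (v ++ t ++ w) (2 + length v)) ∎
      where open ≡-Reasoning

    admits : ∀ i → 2 ≤ i → i ≤ n ∸ 1 → ∀ u → T (W u) → wordSig u (i ∸ 1) ≡ neg (wordSig u i) →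
             Σ (SCG.V G) λ x → E i u (proj₁ x)
    admits (suc (suc k)) (s≤s (s≤s _)) i≤ u u∈ alt
      with ++-splitAt k u (≤-trans (m≤n+m k 2) (≤-trans i≤ (≤-trans (m∸n≤m n 1) (≤-reflexive (sym (word-length D u∈))))))
    ... | v , w₀ , refl , refl with length-3 w₀ (+-cancelˡ-≤ (length v) _ _ (begin
        length v + 3         ≡⟨ +-comm (length v) 3 ⟩
        suc (2 + length v)   ≤⟨ s≤s i≤ ⟩
        suc (n ∸ 1)          ≡⟨ m+[n∸m]≡n (≤-trans (≤-trans (s≤s z≤n) i≤) (m∸n≤m n 1)) ⟩
        n                    ≡⟨ word-length D u∈ ⟨
        length (v ++ w₀)     ≡⟨ length-++ v ⟩
        length v + length w₀ ∎))
      where open ≤-Reasoning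
    ...   | x , y , z , w , refl with Unique-++⁻ʳ v (word-unique D u∈)
    ...     | (x≢y ∷ x≢z ∷ _) ∷ (y≢z ∷ _) ∷ _
      with Triple-classify x≢y x≢z y≢z (trans (sym (wordSig-++ v {x ∷ y ∷ z ∷ w} 0)) (trans alt (cong neg (wordSig-++ v 1))))
    ...       | a , b , c , a<b , b<c , tr with neighbour D v w a<b b<c tr refl i≤ u∈
    ...         | t′ , _ , e = (v ++ t′ ++ w , proj₂ (E-vert e)) , e

  axiom2 : Axiom2 G
  axiom2 i (u , _) (x , _) e with edge-view D e
  ... | view {s = s} {t} {t′} v w a<b b<c tr tr′ =
    trans (trans (wordSig-++ v 0) (proj₁ sig)) (trans (sym (neg-involutive s)) (cong neg (sym (trans (wordSig-++ v 0) (proj₁ sig′))))) ,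
    trans (trans (wordSig-++ v 1) (proj₂ sig)) (cong neg (trans (sym (neg-involutive s)) (sym (trans (wordSig-++ v 1) (proj₂ sig′))))) ,
    far
    where
    sig  = Triple-sig w a<b b<c tr
    sig′ = Triple-sig w a<b b<c tr′
    beyond : ∀ m → nth (v ++ t ++ w) (length v + (3 + m)) ≡ nth (v ++ t′ ++ w) (length v + (3 + m))
    beyond m = trans (trans (nth-++ v (3 + m)) (Triple-nth w m tr))
                     (sym (trans (nth-++ v (3 + m)) (Triple-nth w m tr′)))
    far : ∀ h → 1 ≤ h → h ≤ n ∸ 1 → (h + 2 < 2 + length v ⊎ 2 + length v + 1 < h) →
          wordSig (v ++ t ++ w) h ≡ wordSig (v ++ t′ ++ w) h
    far (suc h) _ _ (inj₁ h+2<i) = cong₂ sgn (nth-prefix v (≤-trans (n≤1+n _) h<)) (nth-prefix v h<)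
      where
      h< : suc h < length v
      h< = +-cancelˡ-< 2 _ _ (subst (_< 2 + length v) (+-comm (suc h) 2) h+2<i)
    far (suc h) _ _ (inj₂ i+1<h) with m≤n⇒∃[o]m+o≡n (≤-pred i+1<h)
    ... | m , refl = cong₂ sgn (at m refl) (at (suc m) (cong suc (sym (+-suc _ m))))
      where
      shift : ∀ m → 2 + length v + 1 + m ≡ length v + (3 + m)
      shift m = begin
        2 + length v + 1 + m ≡⟨ cong (_+ m) (+-comm (2 + length v) 1) ⟩
        3 + length v + m     ≡⟨ cong (_+ m) (+-comm 3 (length v)) ⟩
        length v + 3 + m     ≡⟨ +-assoc (length v) 3 m ⟩
        length v + (3 + m)   ∎
        where open ≡-Reasoning
      at : ∀ m {k} → k ≡ 2 + length v + 1 + m → nth (v ++ t ++ w) k ≡ nth (v ++ t′ ++ w) k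
      at m refl = subst (λ k → nth (v ++ t ++ w) k ≡ nth (v ++ t′ ++ w) k) (sym (shift m)) (beyond m)

  axiom3 : Axiom3 G
  axiom3 i (u , _) (x , _) e with edge-view D e
  ... | view {s = s} {t} {t′} v w a<b b<c tr tr′ = left v , right
    where
    left : ∀ v → 3 ≤ 2 + length v → wordSig (v ++ t ++ w) (length v) ≡ neg (wordSig (v ++ t′ ++ w) (length v)) →
           wordSig (v ++ t ++ w) (length v) ≡ neg (wordSig (v ++ t ++ w) (1 + length v))
    left []      (s≤s (s≤s ())) _
    left v@(p ∷ v₁) _ flips = trans now (trans (go tr tr′ changes) (cong neg (sym (trans (wordSig-++ v 0) (proj₁ (Triple-sig w a<b b<c tr))))))
      where
      P = nth (v ++ t ++ w) (length v₁)
      now : wordSig (v ++ t ++ w) (length v) ≡ sgn P (nth (t ++ w) 0)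
      now = cong (sgn P) (nth-++₀ v)
      now′ : wordSig (v ++ t′ ++ w) (length v) ≡ sgn P (nth (t′ ++ w) 0)
      now′ = cong₂ sgn (nth-prefix v ≤-refl) (nth-++₀ v)
      changes : sgn P (nth (t ++ w) 0) ≢ sgn P (nth (t′ ++ w) 0)
      changes eq = neg⇒≢ flips (trans now (trans eq (sym now′)))
      go : ∀ {s t t′} → Triple _ _ _ s t → Triple _ _ _ (neg s) t′ →
           sgn P (nth (t ++ w) 0) ≢ sgn P (nth (t′ ++ w) 0) → sgn P (nth (t ++ w) 0) ≡ neg s
      go {plus}  tr tr′ ne = proj₁ (sgn-mono (λ lt → <-≤-trans lt (Triple-first w a<b b<c tr tr′)) ne)
      go {minus} tr tr′ ne = proj₂ (sgn-mono (λ lt → <-≤-trans lt (Triple-first w a<b b<c tr′ tr)) (ne ∘ sym))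
    right : 2 + length v + 1 ≤ n ∸ 1 →
            wordSig (v ++ t ++ w) (2 + length v + 1) ≡ neg (wordSig (v ++ t′ ++ w) (2 + length v + 1)) →
            wordSig (v ++ t ++ w) (2 + length v + 1) ≡ neg (wordSig (v ++ t ++ w) (2 + length v))
    right _ flips = trans (at tr) (trans (go tr tr′ changes) (cong neg (sym (trans (wordSig-++ v 1) (proj₂ (Triple-sig w a<b b<c tr))))))
      where
      Q = nth w 0
      at : ∀ {s t} → Triple _ _ _ s t → wordSig (v ++ t ++ w) (2 + length v + 1) ≡ sgn (nth (t ++ w) 2) Q
      at {t = t} tr = trans (cong (wordSig (v ++ t ++ w)) (+-comm (2 + length v) 1))
                      (trans (wordSig-++ v 2) (cong (sgn (nth (t ++ w) 2)) (Triple-nth w 0 tr)))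
      changes : sgn (nth (t ++ w) 2) Q ≢ sgn (nth (t′ ++ w) 2) Q
      changes eq = neg⇒≢ flips (trans (at tr) (trans eq (sym (at tr′))))
      go : ∀ {s t t′} → Triple _ _ _ s t → Triple _ _ _ (neg s) t′ →
           sgn (nth (t ++ w) 2) Q ≢ sgn (nth (t′ ++ w) 2) Q → sgn (nth (t ++ w) 2) Q ≡ neg (neg s)
      go {plus}  tr tr′ ne = proj₂ (sgn-mono {y = Q} {v = Q} (λ lt → ≤-<-trans (Triple-last w a<b b<c tr tr′) lt) (ne ∘ sym))
      go {minus} tr tr′ ne = proj₁ (sgn-mono {y = Q} {v = Q} (λ lt → ≤-<-trans (Triple-last w a<b b<c tr′ tr) lt) ne)

∑-cong-∈ : ∀ (xs : List A) {f g : A → ℕ} → (∀ {x} → x ∈ xs → f x ≡ g x) → ∑ xs f ≡ ∑ xs g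
∑-cong-∈ []       eq = refl
∑-cong-∈ (x ∷ xs) eq = cong₂ _+_ (eq (here refl)) (∑-cong-∈ xs (eq ∘ there))

∑-mono-≤ : ∀ (xs : List A) {f g : A → ℕ} → (∀ x → f x ≤ g x) → ∑ xs f ≤ ∑ xs g
∑-mono-≤ []       le = z≤n
∑-mono-≤ (x ∷ xs) le = +-mono-≤ (le x) (∑-mono-≤ xs le)

∑-mono-< : ∀ {xs : List A} {f g : A → ℕ} → (∀ x → f x ≤ g x) → ∀ {a} → a ∈ xs → f a < g a → ∑ xs f < ∑ xs g
∑-mono-< {xs = x ∷ xs} le (here refl) lt = +-mono-<-≤ lt (∑-mono-≤ xs le)
∑-mono-< {xs = x ∷ xs} le (there a∈)  lt = +-mono-≤-< (le x) (∑-mono-< le a∈ lt)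

∑-1 : ∀ (xs : List A) → ∑ xs (λ _ → 1) ≡ length xs
∑-1 []       = refl
∑-1 (x ∷ xs) = cong suc (∑-1 xs)

indicator-≤1 : ∀ b → indicator b ≤ 1
indicator-≤1 false = z≤n
indicator-≤1 true  = s≤s z≤n

indicator-mono : ∀ {a b} c → a ≤ b → indicator (c <ᵇ a) ≤ indicator (c <ᵇ b)
indicator-mono {a} {b} c a≤b with c <? a
... | yes c<a rewrite <ᵇ-true c<a | <ᵇ-true (<-≤-trans c<a a≤b) = ≤-refl
... | no  c≮a rewrite <ᵇ-false (≮⇒≥ c≮a) = z≤n

-- Standardisation of words

rank : Word → ℕ → ℕ
rank m a = suc (∑ m (λ b → indicator (b <ᵇ a)))

standardise : Word → Word
standardise m = map (rank m) m

-- Rearranging a triple inside a window therefore changes no rank: windows that contain the whole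
-- triple are standardised by one and the same function at both ends of an edge.
rank-↭ : ∀ {m m′} → m ↭ m′ → ∀ a → rank m a ≡ rank m′ a
rank-↭ p a = cong suc (∑-↭ p)

rank-mono-≤ : ∀ m {a b} → a ≤ b → rank m a ≤ rank m b
rank-mono-≤ m a≤b = s≤s (∑-mono-≤ m (λ c → indicator-mono c a≤b))

rank-mono-< : ∀ {m a b} → a ∈ m → a < b → rank m a < rank m b
rank-mono-< {m} {a} {b} a∈ a<b = s≤s (∑-mono-< (λ c → indicator-mono c (<⇒≤ a<b)) a∈
  (subst₂ (λ p q → indicator p < indicator q) (sym (<ᵇ-false (≤-refl {a}))) (sym (<ᵇ-true a<b)) (s≤s z≤n)))

rank-≤-length : ∀ {m a} → a ∈ m → rank m a ≤ length m
rank-≤-length {m} {a} a∈ = subst (rank m a ≤_) (∑-1 m) (∑-mono-< (λ b → indicator-≤1 (b <ᵇ a)) a∈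
  (subst (λ p → indicator p < 1) (sym (<ᵇ-false (≤-refl {a}))) (s≤s z≤n)))

rank-injective : ∀ {m a b} → a ∈ m → b ∈ m → rank m a ≡ rank m b → a ≡ b
rank-injective {a = a} {b} a∈ b∈ eq with <-cmp a b
... | tri< a<b _ _ = contradiction eq (<⇒≢ (rank-mono-< a∈ a<b))
... | tri≈ _ a≡b _ = a≡b
... | tri> _ _ b<a = contradiction (sym eq) (<⇒≢ (rank-mono-< b∈ b<a))

sgn-rank : ∀ {m a b} → a ∈ m → sgn (rank m a) (rank m b) ≡ sgn a b
sgn-rank {m} {a} {b} a∈ with a <? b
... | yes a<b = trans (sgn-< (rank-mono-< a∈ a<b)) (sym (sgn-< a<b))
... | no  a≮b = trans (sgn-≥ (rank-mono-≤ m (≮⇒≥ a≮b))) (sym (sgn-≥ (≮⇒≥ a≮b)))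

nth-∈ : ∀ (m : Word) {k} → k < length m → nth m k ∈ m
nth-∈ (x ∷ m) {zero}  _        = here refl
nth-∈ (x ∷ m) {suc k} (s≤s k<) = there (nth-∈ m k<)

nth-map : ∀ (f : ℕ → ℕ) m {k} → k < length m → nth (map f m) k ≡ f (nth m k)
nth-map f (x ∷ m) {zero}  _        = refl
nth-map f (x ∷ m) {suc k} (s≤s k<) = nth-map f m k<

wordSig-standardise : ∀ m {k} → suc k < length m → wordSig (standardise m) (suc k) ≡ wordSig m (suc k)
wordSig-standardise m k< = trans
  (cong₂ sgn (nth-map (rank m) m (<⇒≤ k<)) (nth-map (rank m) m k<))
  (sgn-rank {b = nth m (suc _)} (nth-∈ m (<⇒≤ k<)))

memberᵇ : ℕ → List ℕ → Bool
memberᵇ x []       = false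
memberᵇ x (y ∷ ys) = if x ≡ᵇ y then true else memberᵇ x ys

distinctᵇ : List ℕ → Bool
distinctᵇ []       = true
distinctᵇ (x ∷ xs) = not (memberᵇ x xs) ∧ distinctᵇ xs

memberᵇ-false : ∀ {x xs} → All (x ≢_) xs → memberᵇ x xs ≡ false
memberᵇ-false []         = refl
memberᵇ-false {x} {y ∷ _} (x≢y ∷ x∉) rewrite ≡ᵇ-false x≢y = memberᵇ-false x∉

distinctᵇ-map : ∀ {f : ℕ → ℕ} {m} → (∀ {a b} → a ∈ m → b ∈ m → f a ≡ f b → a ≡ b) →
                Unique m → distinctᵇ (map f m) ≡ true
distinctᵇ-map inj []        = refl
distinctᵇ-map {f} {x ∷ m} inj (x∉ ∷ uniq) = cong₂ (λ p q → not p ∧ q)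
  (memberᵇ-false (Allₚ.map⁺ (All.tabulate (λ a∈ eq → All.lookup x∉ a∈ (inj (here refl) (there a∈) eq)))))
  (distinctᵇ-map (λ a∈ b∈ → inj (there a∈) (there b∈)) uniq)

∈-allLists : ∀ {M l} → All (λ a → 1 ≤ a × a ≤ M) l → l ∈ allLists (length l) M
∈-allLists []                = here refl
∈-allLists {M} {suc a ∷ l} ((_ , a≤) ∷ bounds) =
  ∈-concatMap⁺ _ (lose (∈-map⁺ suc (∈-upTo⁺ a≤)) (∈-map⁺ (suc a ∷_) (∈-allLists bounds)))

standardise-∈-allLists : ∀ m → standardise m ∈ allLists (length m) (length m)
standardise-∈-allLists m = subst (λ k → standardise m ∈ allLists k (length m)) (length-map (rank m) m)
  (∈-allLists (Allₚ.map⁺ (All.tabulate (λ a∈ → s≤s z≤n , rank-≤-length a∈))))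

-- Certificates of Schur positivity.  A certificate for degree d consists of
-- permutations labelled by shapes and of blocks labelled by descent sets such
-- that, for every permutation π, the fundamental quasisymmetric function of π is
-- the sum of s_μ over the shapes μ labelling π, up to terms which change sign
-- along every edge of a D₀ graph.
--
-- A permutation is written in decimal; a block, i.e. the four arrangements
-- of three letters in positions i − 1, i, i + 1, is written as the digit i followed
-- by the permutation having these three letters in increasing order.  An entry
-- (S , B⁺ , B⁻) of corrections contributes ±Q_S on the blocks in B⁺ and ∓Q_S on those in B⁻,
-- with the upper sign when i − 1 is an ascent.

setSig : List ℕ → ℕ → Sign
setSig S j = if memberᵇ j S then minus else plus

block : Sign → ℕ → Word → Word
block s zero    (x ∷ y ∷ z ∷ w) = sort3 s x y z ++ w
block s (suc o) (x ∷ w)         = x ∷ block s o w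
block s _       w               = w

decimal : List ℕ → ℕ
decimal = foldl (λ c a → 10 * c + a) 0

record Certificate : Set where
  field
    shapes      : List (List ℕ × List ℕ)
    corrections : List (List ℕ × List ℕ × List ℕ)

  shapesOf : Word → List (List ℕ)
  shapesOf π = map proj₁ (filterᵇ (λ e → memberᵇ (decimal π) (proj₂ e)) shapes)

  side : Sign → List ℕ × List ℕ → List ℕ
  side plus  = proj₁
  side minus = proj₂

  terms : Sign → ℕ → List (List ℕ)
  terms s b = map proj₁ (filterᵇ (λ e → memberᵇ b (side s (proj₂ e))) corrections)

  -- At a vertex of sign `s` the signed correction is `terms s` minus `terms (neg s)`. With `f = id`
  -- one gets the part added on the right of `balanced`, with `f = neg` the part to be subtracted,
  -- which is added on the left. Equal signs mean that there is no block at this offset.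
  termsAt : (Sign → Sign) → ℕ → Word → Sign → Sign → List (List ℕ)
  termsAt f o π plus  minus = terms (f plus) (decimal (2 + o ∷ block plus o π))
  termsAt f o π minus plus  = terms (f minus) (decimal (2 + o ∷ block minus o π))
  termsAt f o π _     _     = []

  evaluate : List (List ℕ) → List ℕ → ℕ
  evaluate Ss β = ∑ Ss (λ S → qCoeff (setSig S) β)

  correction : (Sign → Sign) → ℕ → Word → List ℕ → ℕ
  correction f o π β = evaluate (termsAt f o π (wordSig π (1 + o)) (wordSig π (2 + o))) β

  balanced : ℕ → Word → List ℕ → Bool
  balanced d π β =
    (qCoeff (wordSig π) β + ∑ (upTo (d ∸ 2)) (λ o → correction neg o π β))
      ≡ᵇ (∑ (shapesOf π) (λ μ → schurCoeff μ β) + ∑ (upTo (d ∸ 2)) (λ o → correction id o π β))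

  -- All words of length `d` in the letters 1 to `d` are run through, because membership in
  -- `allLists d d` is what `standardise-∈-allLists` provides; those with a repeated letter pass at
  -- once, which leaves S_d.
  verify : ℕ → Bool
  verify d = allB (λ π → if distinctᵇ π then allB (balanced d π) (patterns 1 (d ∸ 1)) else true) (allLists d d)

  verified : ∀ {d m β} → verify d ≡ true → length m ≡ d → Unique m → β ∈ patterns 1 (d ∸ 1) →
             qCoeff (wordSig (standardise m)) β + ∑ (upTo (d ∸ 2)) (λ o → correction neg o (standardise m) β)
             ≡ ∑ (shapesOf (standardise m)) (λ μ → schurCoeff μ β) + ∑ (upTo (d ∸ 2)) (λ o → correction id o (standardise m) β)
  verified {d} {m} {β} ok refl uniq β∈ = ≡ᵇ⇒≡ _ _ (subst T (sym bal) tt)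
    where
    π = standardise m
    rows : (if distinctᵇ π then allB (balanced d π) (patterns 1 (d ∸ 1)) else true) ≡ true
    rows = allB-true _ ok (standardise-∈-allLists m)
    bal : balanced d π β ≡ true
    bal = allB-true _ (trans (cong (if_then allB (balanced d π) (patterns 1 (d ∸ 1)) else true)
            (sym (distinctᵇ-map rank-injective uniq))) rows) β∈

  termsAt-equal : ∀ f o π s → termsAt f o π s s ≡ []
  termsAt-equal f o π plus  = refl
  termsAt-equal f o π minus = refl

  termsAt-opposite : ∀ f o π s → termsAt f o π s (neg s) ≡ terms (f s) (decimal (2 + o ∷ block s o π))
  termsAt-opposite f o π plus  = refl
  termsAt-opposite f o π minus = refl

  block-++ : ∀ s p {xs} → block s (length p) (p ++ xs) ≡ p ++ block s 0 xs
  block-++ s []      = refl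
  block-++ s (x ∷ p) = cong (x ∷_) (block-++ s p)

  block-sort : ∀ {s t l} q → Sorts s t l → block s 0 (t ++ q) ≡ l ++ q
  block-sort {t = x ∷ y ∷ z ∷ []} q refl = refl

  correction-triple : ∀ {a b c s t} f p q β → a < b → b < c → Triple a b c s t →
    correction f (length p) (p ++ t ++ q) β ≡ evaluate (terms (f s) (decimal (2 + length p ∷ p ++ a ∷ b ∷ c ∷ q))) β
  correction-triple {a} {b} {c} {s} {t} f p q β a<b b<c tr = cong (λ Ss → evaluate Ss β) (begin
    termsAt f o π (wordSig π (1 + o)) (wordSig π (2 + o))
      ≡⟨ cong₂ (termsAt f o π) (trans (wordSig-++ p 0) (proj₁ sig)) (trans (wordSig-++ p 1) (proj₂ sig)) ⟩
    termsAt f o π s (neg s)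
      ≡⟨ termsAt-opposite f o π s ⟩
    terms (f s) (decimal (2 + o ∷ block s o π))
      ≡⟨ cong (λ l → terms (f s) (decimal (2 + o ∷ l)))
           (trans (block-++ s p) (cong (p ++_) (block-sort q (Triple-sort a<b b<c tr)))) ⟩
    terms (f s) (decimal (2 + o ∷ p ++ a ∷ b ∷ c ∷ q)) ∎)
    where
    open ≡-Reasoning
    o = length p
    π = p ++ t ++ q
    sig = Triple-sig q a<b b<c tr

Triple-map : ∀ (f : ℕ → ℕ) {a b c s t} → Triple a b c s t → Triple (f a) (f b) (f c) s (map f t)
Triple-map f acb′ = acb′
Triple-map f bca′ = bca′
Triple-map f bac′ = bac′
Triple-map f cab′ = cab′

Triple-↭ : ∀ {a b c s t} → Triple a b c s t → t ↭ a ∷ b ∷ c ∷ []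
Triple-↭ {a} {b} {c} acb′ = prep a (swap c b ↭-refl)
Triple-↭ {a} {b} {c} bca′ = ↭-trans (prep b (swap c a ↭-refl)) (swap b a ↭-refl)
Triple-↭ {a} {b} {c} bac′ = swap b a ↭-refl
Triple-↭ {a} {b} {c} cab′ = ↭-trans (swap c a ↭-refl) (prep a (swap c b ↭-refl))

-- Corrections of standardised words, and windows

module _ (C : Certificate) where
  open Certificate C

  -- On the right the arrangement `t` survives only through its sign `s`: the ranks `r` are taken in
  -- the word with the triple sorted, which all four arrangements share.
  correction-standardise : ∀ {a b c s t} f p q β → a < b → b < c → Triple a b c s t →
    let r = rank (p ++ (a ∷ b ∷ c ∷ []) ++ q) in
    correction f (length p) (standardise (p ++ t ++ q)) β ≡
    evaluate (terms (f s) (decimal (2 + length p ∷ map r p ++ r a ∷ r b ∷ r c ∷ map r q))) β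
  correction-standardise {a} {b} {c} {s} {t} f p q β a<b b<c tr = begin
    correction f (length p) (standardise (p ++ t ++ q)) β
      ≡⟨ cong₂ (λ o π → correction f o π β) (sym (length-map r p)) split ⟩
    correction f (length (map r p)) (map r p ++ map r t ++ map r q) β
      ≡⟨ correction-triple f (map r p) (map r q) β (rank-mono-< a∈ a<b) (rank-mono-< b∈ b<c) (Triple-map r tr) ⟩
    evaluate (terms (f s) (decimal (2 + length (map r p) ∷ map r p ++ r a ∷ r b ∷ r c ∷ map r q))) β
      ≡⟨ cong (λ o → evaluate (terms (f s) (decimal (2 + o ∷ map r p ++ r a ∷ r b ∷ r c ∷ map r q))) β) (length-map r p) ⟩
    evaluate (terms (f s) (decimal (2 + length p ∷ map r p ++ r a ∷ r b ∷ r c ∷ map r q))) β ∎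
    where
    open ≡-Reasoning
    r = rank (p ++ (a ∷ b ∷ c ∷ []) ++ q)
    a∈ : a ∈ p ++ (a ∷ b ∷ c ∷ []) ++ q
    a∈ = ∈-++⁺ʳ p (here refl)
    b∈ : b ∈ p ++ (a ∷ b ∷ c ∷ []) ++ q
    b∈ = ∈-++⁺ʳ p (there (here refl))
    split : standardise (p ++ t ++ q) ≡ map r p ++ map r t ++ map r q
    split = trans (map-cong (rank-↭ (Perm.++⁺ˡ p (Perm.++⁺ʳ q (Triple-↭ tr)))) (p ++ t ++ q))
                  (trans (map-++ r p (t ++ q)) (cong (map r p ++_) (map-++ r t q)))

window : ℕ → ℕ → Word → Word
window k d u = take d (drop k u)

window-++ : ∀ (v m w : Word) → window (length v) (length m) (v ++ m ++ w) ≡ m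
window-++ []      []      w = refl
window-++ []      (x ∷ m) w = cong (x ∷_) (window-++ [] m w)
window-++ (x ∷ v) m       w = window-++ v m w

window-split : ∀ k d (u : Word) → k + d ≤ length u →
               ∃ λ v → ∃ λ w → u ≡ v ++ window k d u ++ w × length v ≡ k × length (window k d u) ≡ d
window-split k d u k+d≤ with ++-splitAt k u (≤-trans (m≤m+n k d) k+d≤)
... | v , w₀ , refl , refl with ++-splitAt d w₀ (+-cancelˡ-≤ (length v) _ _ (≤-trans k+d≤ (≤-reflexive (length-++ v))))
...   | m , w , refl , refl = v , w , cong (λ m → v ++ m ++ w) (sym (window-++ v m w)) , refl , cong length (window-++ v m w)

qOK-cong : ∀ {s s′} j α → (∀ k → j ≤ k → suc k < j + length α → s k ≡ s′ k) → qOK s j α ≡ qOK s′ j α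
qOK-cong j []          eq = refl
qOK-cong j (a ∷ [])    eq = refl
qOK-cong j (a ∷ b ∷ α) eq = cong₂ (λ s c → (if isMinus s then a <ᵇ b else true) ∧ c)
  (eq j ≤-refl (≤-trans (≤-reflexive (+-comm 2 j)) (+-monoʳ-≤ j (s≤s (s≤s z≤n)))))
  (qOK-cong (suc j) (b ∷ α) (λ k j<k k< → eq k (<⇒≤ j<k) (≤-trans k< (≤-reflexive (sym (+-suc j _))))))

qCoeff-cong : ∀ {s s′} α → (∀ k → suc k < length α → s (suc k) ≡ s′ (suc k)) → qCoeff s α ≡ qCoeff s′ α
qCoeff-cong α eq = cong (λ b → if b then 1 else 0) (qOK-cong 1 α λ { (suc k) _ (s≤s k<) → eq k k< })

component-closed : ∀ {n} (G : SCG n) {i j w L} → IsComponent G i j w L →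
                   ∀ {x y} → x ∈ L → ResStep G i j x y → y ∈ L
component-closed G (_ , mem) x∈ step = proj₂ (mem _) (proj₁ (mem _) x∈ ◅◅ step ◅ done)

-- Cancellation over a component and local Schur positivity

module _ {N n : ℕ} (D : D0Graph N n) where
  open D0Graph D

  private
    G = toSCG D
    V = SCG.V G

  module Switch (i : ℕ) (2≤i : 2 ≤ i) (i≤ : i ≤ n ∸ 1) where

    -- A vertex without an `i`-edge is its own partner, which makes `ι` a total involution. The
    -- second alternative keeps the equality of signs, by which the correction at such a vertex is
    -- zero.
    Switched : V → V → Set
    Switched v x = E i (proj₁ v) (proj₁ x) ⊎ x ≡ v × wordSig (proj₁ v) (i ∸ 1) ≡ wordSig (proj₁ v) i

    switch : ∀ v → Σ V (Switched v)
    switch v with Sign-cases (wordSig (proj₁ v) (i ∸ 1)) (wordSig (proj₁ v) i)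
    ... | inj₁ same = v , inj₂ (refl , same)
    ... | inj₂ alt with proj₂ (proj₂ (axiom1 D) i 2≤i i≤ v) alt
    ...   | x , e = x , inj₁ e

    ι : V → V
    ι = proj₁ ∘ switch

    no-edge : ∀ v x → wordSig (proj₁ v) (i ∸ 1) ≡ wordSig (proj₁ v) i → ¬ E i (proj₁ v) (proj₁ x)
    no-edge v x same e = neg⇒≢ (proj₁ (proj₂ (axiom1 D) i 2≤i i≤ v) (x , e)) same

    ι-involutive : ∀ v → ι (ι v) ≡ v
    ι-involutive v with switch v
    ... | x , inj₂ (refl , same) with switch x
    ...   | y , inj₁ e = contradiction e (no-edge x y same)
    ...   | y , inj₂ (refl , _) = refl
    ι-involutive v | x , inj₁ e with switch x
    ...   | y , inj₁ e′ = axiom0 D i x y v e′ (E-sym e)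
    ...   | y , inj₂ (refl , same) = contradiction (E-sym e) (no-edge x v same)

    sum-switch : ∀ {a b w L} → a + 1 ≤ i → i ≤ b ∸ 1 → IsComponent G a b w L →
                 ∀ {f : V → ℕ} → ∑ L (f ∘ ι) ≡ ∑ L f
    sum-switch {a} {b} {L = L} lo hi comp = ∑-involution ι L (proj₁ comp) ι-involutive closed
      where
      closed : ∀ {x} → x ∈ L → ι x ∈ L
      closed {x} x∈ with switch x
      ... | y , inj₁ e          = component-closed G {a} {b} comp x∈ (i , (lo , hi) , inj₁ e)
      ... | y , inj₂ (refl , _) = x∈

  module _ (C : Certificate) (d : ℕ) (k : ℕ) (k+d≤n : k + d ≤ n) where
    open Certificate C

    private
      letters : V → Word
      letters v = window k d (proj₁ v)

      π : V → Word
      π v = standardise (letters v)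

    letters-split : ∀ (v : V) → ∃ λ x → ∃ λ y → proj₁ v ≡ x ++ letters v ++ y × length x ≡ k × length (letters v) ≡ d
    letters-split (u , u∈) = window-split k d u (≤-trans k+d≤n (≤-reflexive (sym (word-length D u∈))))

    letters-length : ∀ v → length (letters v) ≡ d
    letters-length v with letters-split v
    ... | _ , _ , _ , _ , len = len

    letters-unique : ∀ v → Unique (letters v)
    letters-unique v@(u , u∈) with letters-split v
    ... | x , y , u≡ , _ = Unique-++⁻ˡ (letters v) (Unique-++⁻ʳ x (subst Unique u≡ (word-unique D u∈)))

    π-sig : ∀ v l → suc l < d → wordSig (π v) (suc l) ≡ wordSig (proj₁ v) (suc l + k)
    π-sig v l l< with letters-split v
    ... | x , y , u≡ , refl , len = begin
      wordSig (π v) (suc l)                              ≡⟨ wordSig-standardise (letters v) l<′ ⟩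
      wordSig (letters v) (suc l)                        ≡⟨ cong (λ m → wordSig m (suc l)) (sym (++-identityʳ (letters v))) ⟩
      wordSig (letters v ++ []) (suc l)                  ≡⟨ cong₂ sgn (nth-prefix (letters v) (<⇒≤ l<′)) (nth-prefix (letters v) l<′) ⟩
      wordSig (letters v ++ y) (suc l)                   ≡⟨ wordSig-++ x l ⟨
      wordSig (x ++ letters v ++ y) (suc l + length x)   ≡⟨ cong (λ u → wordSig u (suc l + length x)) u≡ ⟨
      wordSig (proj₁ v) (suc l + length x)               ∎
      where
      open ≡-Reasoning
      l<′ : suc l < length (letters v)
      l<′ = subst (suc l <_) (sym len) l<

    module _ (o : ℕ) (o+3≤d : o + 3 ≤ d) where

      -- The ends of an edge share their sorted block and have opposite signs, so `neg` at one end
      -- selects the same list of terms as `id` at the other.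
      correction-edge : ∀ {v x : V} β → E (2 + (k + o)) (proj₁ v) (proj₁ x) →
                        correction neg o (π v) β ≡ correction id o (π x) β
      correction-edge {u , u∈} {x , _} β e = go refl u∈ (edge-view D e)
        where
        go : ∀ {i u x} → i ≡ 2 + (k + o) → T (W u) → EdgeView i u x →
             correction neg o (standardise (window k d u)) β ≡ correction id o (standardise (window k d x)) β
        -- The word is cut into `v₁`, `p`, the triple, `q` and `y`, of which `v₁` has `k` letters,
        -- `p` has `o` and `q` has `d ∸ (o + 3)`; the window is then `p`, the triple and `q`.
        go i≡ u∈ (view {a} {b} {c} {s} {t} {t′} v w a<b b<c tr tr′)
          with ++-splitAt k v (≤-trans (m≤m+n k o) (≤-reflexive (sym (suc-injective (suc-injective i≡)))))
        ... | v₁ , p , refl , refl with ++-splitAt (d ∸ (o + 3)) w w-long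
          where
          w-long : d ∸ (o + 3) ≤ length w
          w-long = +-cancelˡ-≤ (length (v₁ ++ p) + 3) _ _ (begin
            length (v₁ ++ p) + 3 + (d ∸ (o + 3))   ≡⟨ cong (λ l → l + 3 + (d ∸ (o + 3))) (suc-injective (suc-injective i≡)) ⟩
            length v₁ + o + 3 + (d ∸ (o + 3))      ≡⟨ cong (_+ (d ∸ (o + 3))) (+-assoc (length v₁) o 3) ⟩
            length v₁ + (o + 3) + (d ∸ (o + 3))    ≡⟨ +-assoc (length v₁) (o + 3) _ ⟩
            length v₁ + (o + 3 + (d ∸ (o + 3)))    ≡⟨ cong (length v₁ +_) (m+[n∸m]≡n o+3≤d) ⟩
            length v₁ + d                          ≤⟨ k+d≤n ⟩
            n                                      ≡⟨ word-length D u∈ ⟨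
            length ((v₁ ++ p) ++ t ++ w)           ≡⟨ length-++ (v₁ ++ p) ⟩
            length (v₁ ++ p) + length (t ++ w)     ≡⟨ cong (length (v₁ ++ p) +_) (trans (length-++ t) (cong (_+ length w) (Triple-length tr))) ⟩
            length (v₁ ++ p) + (3 + length w)      ≡⟨ +-assoc (length (v₁ ++ p)) 3 _ ⟨
            length (v₁ ++ p) + 3 + length w        ∎)
            where open ≤-Reasoning
        ...   | q , y , refl , q-len = begin
          correction neg o (standardise (window k d ((v₁ ++ p) ++ t ++ q ++ y))) β
            ≡⟨ cong₂ (λ o m → correction neg o (standardise m) β) (sym p-len) (local tr) ⟩
          correction neg (length p) (standardise (p ++ t ++ q)) β
            ≡⟨ correction-standardise C neg p q β a<b b<c tr ⟩
          _ ≡⟨ correction-standardise C id p q β a<b b<c tr′ ⟨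
          correction id (length p) (standardise (p ++ t′ ++ q)) β
            ≡⟨ cong₂ (λ o m → correction id o (standardise m) β) p-len (sym (local tr′)) ⟩
          correction id o (standardise (window k d ((v₁ ++ p) ++ t′ ++ q ++ y))) β ∎
          where
          open ≡-Reasoning
          p-len : length p ≡ o
          p-len = +-cancelˡ-≡ (length v₁) _ _ (trans (sym (length-++ v₁)) (suc-injective (suc-injective i≡)))
          local : ∀ {s t} → Triple a b c s t → window k d ((v₁ ++ p) ++ t ++ q ++ y) ≡ p ++ t ++ q
          local {t = t} tr = trans (cong₂ (window k) d≡ reassoc) (window-++ v₁ (p ++ t ++ q) y)
            where
            reassoc : (v₁ ++ p) ++ t ++ q ++ y ≡ v₁ ++ (p ++ t ++ q) ++ y
            reassoc = trans (++-assoc v₁ p _) (cong (v₁ ++_) (sym (trans (++-assoc p (t ++ q) y) (cong (p ++_) (++-assoc t q y)))))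
            d≡ : d ≡ length (p ++ t ++ q)
            d≡ = begin
              d                                ≡⟨ m+[n∸m]≡n o+3≤d ⟨
              o + 3 + (d ∸ (o + 3))            ≡⟨ +-assoc o 3 _ ⟩
              o + (3 + (d ∸ (o + 3)))          ≡⟨ cong₂ _+_ p-len (cong₂ _+_ (Triple-length tr) q-len) ⟨
              length p + (length t + length q) ≡⟨ cong (length p +_) (length-++ t) ⟨
              length p + length (t ++ q)       ≡⟨ length-++ p ⟨
              length (p ++ t ++ q)             ∎

      correction-flat : ∀ f v β → wordSig (proj₁ v) (1 + (k + o)) ≡ wordSig (proj₁ v) (2 + (k + o)) →
                        correction f o (π v) β ≡ 0
      correction-flat f v β same = cong (λ Ss → evaluate Ss β)
        (trans (cong (termsAt f o (π v) (wordSig (π v) (1 + o))) (sym same′)) (termsAt-equal f o (π v) (wordSig (π v) (1 + o))))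
        where
        same′ : wordSig (π v) (1 + o) ≡ wordSig (π v) (2 + o)
        same′ = begin
          wordSig (π v) (1 + o)              ≡⟨ π-sig v o (≤-trans (≤-trans (≤-reflexive (+-comm 2 o)) (+-monoʳ-≤ o (n≤1+n 2))) o+3≤d) ⟩
          wordSig (proj₁ v) (1 + o + k)      ≡⟨ cong (λ l → wordSig (proj₁ v) (1 + l)) (+-comm o k) ⟩
          wordSig (proj₁ v) (1 + (k + o))    ≡⟨ same ⟩
          wordSig (proj₁ v) (2 + (k + o))    ≡⟨ cong (λ l → wordSig (proj₁ v) (2 + l)) (+-comm k o) ⟩
          wordSig (proj₁ v) (2 + o + k)      ≡⟨ π-sig v (1 + o) (≤-trans (≤-reflexive (+-comm 3 o)) o+3≤d) ⟨
          wordSig (π v) (2 + o)              ∎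
          where open ≡-Reasoning

      ∑-correction : ∀ {w L} β → IsComponent G (suc k) (k + d) w L →
                     ∑ L (λ v → correction neg o (π v) β) ≡ ∑ L (λ v → correction id o (π v) β)
      ∑-correction {L = L} β comp = trans (∑-cong L at) (sum-switch {suc k} {k + d}
        (≤-trans (≤-reflexive (+-comm (suc k) 1)) (s≤s (s≤s (m≤m+n k o)))) hi comp)
        where
        hi′ : 3 + (k + o) ≤ k + d
        hi′ = ≤-trans (≤-reflexive (trans (+-comm 3 (k + o)) (+-assoc k o 3))) (+-monoʳ-≤ k o+3≤d)
        hi : 2 + (k + o) ≤ k + d ∸ 1
        hi = ∸-monoˡ-≤ 1 hi′
        open Switch (2 + (k + o)) (s≤s (s≤s z≤n)) (≤-trans hi (∸-monoˡ-≤ 1 k+d≤n))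
        at : ∀ v → correction neg o (π v) β ≡ correction id o (π (ι v)) β
        at v with switch v
        ... | x , inj₁ e             = correction-edge {v} {x} β e
        ... | _ , inj₂ (refl , same) = trans (correction-flat neg v β same) (sym (correction-flat id v β same))

    -- The expansion lists the shapes attached to each vertex of the component. At a single vertex
    -- the corrections `P` and `Q` may differ; their totals over the component agree, colour by
    -- colour, and are cancelled.
    schurPositive : verify d ≡ true → All (IsPartition d) (map proj₁ shapes) → 1 ≤ d →
                    ∀ {w L} → IsComponent G (suc k) (k + d) w L → SchurPositive d (compGF G (suc k) L)
    schurPositive ok partitions (s≤s _) {L = L} comp =
      concatMap (shapesOf ∘ π) L , Allₚ.concat⁺ (Allₚ.map⁺ (All.universal (shapesOf-partition ∘ π) L)) , expansion
      where
      shapesOf-partition : ∀ ρ → All (IsPartition d) (shapesOf ρ)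
      shapesOf-partition ρ = Allₚ.map⁺ (Allₚ.filter⁺ _ (Allₚ.map⁻ partitions))
      offsets = upTo (d ∸ 2)
      expansion : ∀ α → IsMonomial d α → compGF G (suc k) L α ≡ ∑ (concatMap (shapesOf ∘ π) L) (λ μ → schurCoeff μ α)
      expansion α mono@(len , _) with normalForm mono
      ... | β , β∈ , schur≡ , q≡ = begin
        compGF G (suc k) L α                          ≡⟨ ∑-cong L (λ v → trans (qCoeff-cong α (sig≡ v)) (q≡ _)) ⟩
        ∑ L (λ v → qCoeff (wordSig (π v)) β)          ≡⟨ +-cancelʳ-≡ (∑ L Q) _ _ balance ⟩
        ∑ L (λ v → ∑ (shapesOf (π v)) (λ μ → schurCoeff μ β)) ≡⟨ ∑-concatMap (shapesOf ∘ π) L ⟨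
        ∑ (concatMap (shapesOf ∘ π) L) (λ μ → schurCoeff μ β) ≡⟨ ∑-cong (concatMap (shapesOf ∘ π) L) schur≡ ⟨
        ∑ (concatMap (shapesOf ∘ π) L) (λ μ → schurCoeff μ α) ∎
        where
        open ≡-Reasoning
        P Q : V → ℕ
        P v = ∑ offsets (λ o → correction neg o (π v) β)
        Q v = ∑ offsets (λ o → correction id o (π v) β)
        sig≡ : ∀ v l → suc l < length α → resSig G (suc k) v (suc l) ≡ wordSig (π v) (suc l)
        sig≡ v l l< = trans (cong (wordSig (proj₁ v)) (+-suc l k)) (sym (π-sig v l (subst (suc l <_) len l<)))
        P≡Q : ∑ L P ≡ ∑ L Q
        P≡Q = begin
          ∑ L P                                                    ≡⟨ ∑-swap L offsets ⟩
          ∑ offsets (λ o → ∑ L (λ v → correction neg o (π v) β))   ≡⟨ ∑-cong-∈ offsets (λ {o} o∈ → ∑-correction o (offset-bound o∈) β comp) ⟩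
          ∑ offsets (λ o → ∑ L (λ v → correction id o (π v) β))    ≡⟨ ∑-swap L offsets ⟨
          ∑ L Q                                                    ∎
          where
          offset-bound : ∀ {o} → o ∈ offsets → o + 3 ≤ d
          offset-bound {o} o∈ = ≤-trans (≤-reflexive (+-suc o 2))
            (≤-trans (+-monoˡ-≤ 2 (∈-upTo⁻ o∈)) (≤-reflexive (m∸n+n≡m {d} {2} (<⇒≤ (m∸n≢0⇒n<m {d} {2} (λ eq → n≮0 (subst (o <_) eq (∈-upTo⁻ o∈))))))))
        balance : ∑ L (λ v → qCoeff (wordSig (π v)) β) + ∑ L Q ≡ ∑ L (λ v → ∑ (shapesOf (π v)) (λ μ → schurCoeff μ β)) + ∑ L Q
        balance = begin
          ∑ L (λ v → qCoeff (wordSig (π v)) β) + ∑ L Q  ≡⟨ cong (∑ L _ +_) P≡Q ⟨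
          ∑ L (λ v → qCoeff (wordSig (π v)) β) + ∑ L P  ≡⟨ ∑-+ L ⟨
          ∑ L (λ v → qCoeff (wordSig (π v)) β + P v)    ≡⟨ ∑-cong L (λ v → verified ok (letters-length v) (letters-unique v) β∈) ⟩
          ∑ L (λ v → ∑ (shapesOf (π v)) (λ μ → schurCoeff μ β) + Q v) ≡⟨ ∑-+ L ⟩
          ∑ L (λ v → ∑ (shapesOf (π v)) (λ μ → schurCoeff μ β)) + ∑ L Q ∎

  certificate⇒LSP : ∀ C d → Certificate.verify C d ≡ true → 1 ≤ d →
                    All (IsPartition d) (map proj₁ (Certificate.shapes C)) → LSP G d
  certificate⇒LSP C d ok 1≤d partitions (suc k) j _ j≤n eq w L comp
    with suc-injective (trans (+-comm 1 j) eq)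
  ... | refl = schurPositive C d k j≤n ok partitions 1≤d comp

-- Axiom 4′a

-- The two cases of axiom 4′a differ by reversing the order of the letters; both are
-- treated at once by letting ≺ be < or >.
Lt : Sign → ℕ → ℕ → Set
Lt plus  x y = x < y
Lt minus x y = y < x

Lt-trans : ∀ ε {x y z} → Lt ε x y → Lt ε y z → Lt ε x z
Lt-trans plus  x<y y<z = <-trans x<y y<z
Lt-trans minus y<x z<y = <-trans z<y y<x

Lt⇒≢ : ∀ ε {x y} → Lt ε x y → x ≢ y
Lt⇒≢ plus  = <⇒≢
Lt⇒≢ minus = >⇒≢

sgn-up : ∀ ε {x y} → Lt ε x y → sgn x y ≡ ε
sgn-up plus  = sgn-<
sgn-up minus = sgn->

sgn-down : ∀ ε {x y} → Lt ε y x → sgn x y ≡ neg ε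
sgn-down plus  = sgn->
sgn-down minus = sgn-<

threeSigns : Sign → Sign → Sign → ℕ → Sign
threeSigns a b c (suc zero)       = a
threeSigns a b c (suc (suc zero)) = b
threeSigns a b c _                = c

zigzagSigns : Sign → List (ℕ → Sign)
zigzagSigns ε = threeSigns (neg ε) ε ε ∷ threeSigns ε (neg ε) ε ∷ threeSigns (neg ε) ε (neg ε) ∷
                threeSigns ε (neg ε) ε ∷ threeSigns ε ε (neg ε) ∷ []

module _ {N n : ℕ} (D : D0Graph N n) where
  open D0Graph D

  private
    G = toSCG D
    V = SCG.V G

  Signs : ℕ → V → Sign → Sign → Sign → Set
  Signs k x a b c =
    wordSig (proj₁ x) (1 + k) ≡ a × wordSig (proj₁ x) (2 + k) ≡ b × wordSig (proj₁ x) (3 + k) ≡ c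

  -- For ε = + a component of Res_{[k+1,k+4]} with generating function s₃₁ + s₂₂, for ε = −
  -- one with s₂₁₁ + s₂₂.
  record Zigzag (ε : Sign) (k : ℕ) : Set where
    field
      {x₁ x₂ x₃ x₄ x₅} : V
      e₁₂ : E (2 + k) (proj₁ x₁) (proj₁ x₂)
      e₂₃ : E (3 + k) (proj₁ x₂) (proj₁ x₃)
      e₃₄ : E (2 + k) (proj₁ x₃) (proj₁ x₄)
      e₄₅ : E (3 + k) (proj₁ x₄) (proj₁ x₅)
      s₁  : Signs k x₁ (neg ε) ε ε
      s₂  : Signs k x₂ ε (neg ε) ε
      s₃  : Signs k x₃ (neg ε) ε (neg ε)
      s₄  : Signs k x₄ ε (neg ε) ε
      s₅  : Signs k x₅ ε ε (neg ε)

    vertices : List V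
    vertices = x₁ ∷ x₂ ∷ x₃ ∷ x₄ ∷ x₅ ∷ []

    private
      Step : V → V → Set
      Step = ResStep G (suc k) (4 + k)

      lower : ∀ (x y : V) → E (2 + k) (proj₁ x) (proj₁ y) → Star Step x y
      lower x y e = _◅_ {j = y} (2 + k , (≤-reflexive (+-comm (suc k) 1) , n≤1+n _) , inj₁ e) done

      upper : ∀ (x y : V) → E (3 + k) (proj₁ x) (proj₁ y) → Star Step x y
      upper x y e = _◅_ {j = y} (3 + k , (≤-trans (≤-reflexive (+-comm (suc k) 1)) (n≤1+n _) , ≤-refl) , inj₁ e) done

      step-cases : ∀ {x y} → Step x y → E (2 + k) (proj₁ x) (proj₁ y) ⊎ E (3 + k) (proj₁ x) (proj₁ y)
      step-cases {x} {y} (s , (lo , hi) , e) with m≤n⇒m<n∨m≡n (≤-trans (≤-reflexive (+-comm 1 (suc k))) lo)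
      ... | inj₂ refl = inj₁ (oriented e)
        where
        oriented : E s (proj₁ x) (proj₁ y) ⊎ E s (proj₁ y) (proj₁ x) → E s (proj₁ x) (proj₁ y)
        oriented (inj₁ e) = e
        oriented (inj₂ e) = E-sym e
      ... | inj₁ lt with ≤-antisym lt hi
      ...   | refl = inj₂ (oriented e)
        where
        oriented : E s (proj₁ x) (proj₁ y) ⊎ E s (proj₁ y) (proj₁ x) → E s (proj₁ x) (proj₁ y)
        oriented (inj₁ e) = e
        oriented (inj₂ e) = E-sym e

      no-edge : ∀ {i} (x y : V) {s} → wordSig (proj₁ x) (i ∸ 1) ≡ s → wordSig (proj₁ x) i ≡ s → ¬ E i (proj₁ x) (proj₁ y)
      no-edge {i} x y eq eq′ e = neg⇒≢
        (proj₁ (proj₂ (axiom1 D) i (proj₁ (E-col e)) (proj₂ (E-col e)) x) (y , e)) (trans eq (sym eq′))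

      same : ∀ {i u} (x y : V) → E i u (proj₁ x) → E i u (proj₁ y) → x ≡ y
      same _ _ e e′ = V-≡ D (E-functional D e e′)

      differ : ∀ {x y : V} i {s} → wordSig (proj₁ x) i ≡ s → wordSig (proj₁ y) i ≡ neg s → x ≢ y
      differ i {s} eq eq′ refl = neg-≢ s (trans (sym eq) eq′)

      differ′ : ∀ {x y : V} i {s} → wordSig (proj₁ x) i ≡ neg s → wordSig (proj₁ y) i ≡ s → x ≢ y
      differ′ i eq eq′ = differ i eq′ eq ∘ sym

      -- The inner vertices have their edges of both colours on the path. At `x₁` and at `x₅` two
      -- consecutive signs agree, which by axiom 1 excludes an edge of the other colour.
      closed : ∀ {x y} → x ∈ vertices → Step x y → y ∈ vertices
      closed {x} {y} x∈ st = go x∈ (step-cases {x} {y} st)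
        where
        go : ∀ {x} → x ∈ vertices → E (2 + k) (proj₁ x) (proj₁ y) ⊎ E (3 + k) (proj₁ x) (proj₁ y) → y ∈ vertices
        go (here refl)                                 (inj₁ e) = there (here (same y x₂ e e₁₂))
        go (here refl)                                 (inj₂ e) = contradiction e (no-edge x₁ y (proj₁ (proj₂ s₁)) (proj₂ (proj₂ s₁)))
        go (there (here refl))                         (inj₁ e) = here (same y x₁ e (E-sym e₁₂))
        go (there (here refl))                         (inj₂ e) = there (there (here (same y x₃ e e₂₃)))
        go (there (there (here refl)))                 (inj₁ e) = there (there (there (here (same y x₄ e e₃₄))))
        go (there (there (here refl)))                 (inj₂ e) = there (here (same y x₂ e (E-sym e₂₃)))
        go (there (there (there (here refl))))         (inj₁ e) = there (there (here (same y x₃ e (E-sym e₃₄))))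
        go (there (there (there (here refl))))         (inj₂ e) = there (there (there (there (here (same y x₅ e e₄₅)))))
        go (there (there (there (there (here refl))))) (inj₁ e) = contradiction e (no-edge x₅ y (proj₁ s₅) (proj₁ (proj₂ s₅)))
        go (there (there (there (there (here refl))))) (inj₂ e) = there (there (there (here (same y x₄ e (E-sym e₄₅)))))

      closed-star : ∀ {x y} → x ∈ vertices → Star Step x y → y ∈ vertices
      closed-star x∈ done       = x∈
      closed-star {x} x∈ (_◅_ {j = y} st sts) = closed-star (closed {x} {y} x∈ st) sts

      to-x₃ : ∀ {x} → x ∈ vertices → Star Step x x₃
      to-x₃ (here refl)                                 = lower x₁ x₂ e₁₂ ◅◅ upper x₂ x₃ e₂₃
      to-x₃ (there (here refl))                         = upper x₂ x₃ e₂₃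
      to-x₃ (there (there (here refl)))                 = done
      to-x₃ (there (there (there (here refl))))         = lower x₄ x₃ (E-sym e₃₄)
      to-x₃ (there (there (there (there (here refl))))) = upper x₅ x₄ (E-sym e₄₅) ◅◅ lower x₄ x₃ (E-sym e₃₄)

      from-x₃ : ∀ {x} → x ∈ vertices → Star Step x₃ x
      from-x₃ (here refl)                                 = upper x₃ x₂ (E-sym e₂₃) ◅◅ lower x₂ x₁ (E-sym e₁₂)
      from-x₃ (there (here refl))                         = upper x₃ x₂ (E-sym e₂₃)
      from-x₃ (there (there (here refl)))                 = done
      from-x₃ (there (there (there (here refl))))         = lower x₃ x₄ e₃₄
      from-x₃ (there (there (there (there (here refl))))) = lower x₃ x₄ e₃₄ ◅◅ upper x₄ x₅ e₄₅

      x₁≢x₃ : x₁ ≢ x₃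
      x₁≢x₃ = differ (3 + k) (proj₂ (proj₂ s₁)) (proj₂ (proj₂ s₃))

      -- These two vertices have the same three signs, so their neighbours must tell them apart:
      -- along the lower colour they lead to `x₁` and `x₃`, which differ.
      x₂≢x₄ : x₂ ≢ x₄
      x₂≢x₄ eq = x₁≢x₃ (same x₁ x₃ (E-sym e₁₂)
        (subst (λ x → E (2 + k) (proj₁ x) (proj₁ x₃)) (sym eq) (E-sym e₃₄)))

      vertices-unique : Unique vertices
      vertices-unique =
        (differ (2 + k) (proj₁ (proj₂ s₁)) (proj₁ (proj₂ s₂)) ∷ x₁≢x₃ ∷
         differ (2 + k) (proj₁ (proj₂ s₁)) (proj₁ (proj₂ s₄)) ∷ differ′ (1 + k) (proj₁ s₁) (proj₁ s₅) ∷ []) ∷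
        (differ (1 + k) (proj₁ s₂) (proj₁ s₃) ∷ x₂≢x₄ ∷ differ′ (2 + k) (proj₁ (proj₂ s₂)) (proj₁ (proj₂ s₅)) ∷ []) ∷
        (differ′ (1 + k) (proj₁ s₃) (proj₁ s₄) ∷ differ′ (1 + k) (proj₁ s₃) (proj₁ s₅) ∷ []) ∷
        (differ′ (2 + k) (proj₁ (proj₂ s₄)) (proj₁ (proj₂ s₅)) ∷ []) ∷ [] ∷ []

      qCoeff-signs : ∀ {x : V} {a b c} α → length α ≡ 4 → Signs k x a b c →
                     qCoeff (resSig G (suc k) x) α ≡ qCoeff (threeSigns a b c) α
      qCoeff-signs {x} {a} {b} {c} α len (eq₁ , eq₂ , eq₃) = qCoeff-cong α λ l l< → at l (subst (suc l <_) len l<)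
        where
        at : ∀ l → suc l < 4 → wordSig (proj₁ x) (l + suc k) ≡ threeSigns a b c (suc l)
        at 0 _ = eq₁
        at 1 _ = eq₂
        at 2 _ = eq₃
        at (suc (suc (suc l))) (s≤s (s≤s (s≤s (s≤s ()))))

    generatingFunction : ∀ {w L} → w ∈ vertices → IsComponent G (suc k) (4 + k) w L → ∀ α → length α ≡ 4 →
                         compGF G (suc k) L α ≡ ∑ (zigzagSigns ε) (λ s → qCoeff s α)
    generatingFunction {w} {L} w∈ (uniq , mem) α len = trans
      (∑-↭ (∼bag⇒↭ (unique∧set⇒bag uniq vertices-unique
        (mk⇔ (λ x∈ → closed-star w∈ (proj₁ (mem _) x∈)) (λ x∈ → proj₂ (mem _) (to-x₃ w∈ ◅◅ from-x₃ x∈))))))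
      (cong₂ _+_ (qCoeff-signs {x₁} α len s₁) (cong₂ _+_ (qCoeff-signs {x₂} α len s₂)
        (cong₂ _+_ (qCoeff-signs {x₃} α len s₃) (cong₂ _+_ (qCoeff-signs {x₄} α len s₄)
          (cong (_+ 0) (qCoeff-signs {x₅} α len s₅))))))

  neighbour-Lt : ∀ ε {a b c s t} v w → Lt ε a b → Lt ε b c → Triple a b c s t →
                 2 + length v ≤ n ∸ 1 → T (W (v ++ t ++ w)) →
                 Σ Word λ t′ → Triple a b c (neg s) t′ × E (2 + length v) (v ++ t ++ w) (v ++ t′ ++ w)
  neighbour-Lt plus  v w a<b b<c tr i≤ u∈ = neighbour D v w a<b b<c tr refl i≤ u∈
  neighbour-Lt minus {s = s} v w b<a c<b tr i≤ u∈ with neighbour D v w c<b b<a (Triple-reverse tr) refl i≤ u∈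
  ... | t′ , tr′ , e = t′ , subst (λ s → Triple _ _ _ s t′) (neg-involutive (neg s)) (Triple-reverse tr′) , e

  module FiveLetters (ε : Sign) (v w : Word) {a p b q c : ℕ}
                     (a≺p : Lt ε a p) (p≺b : Lt ε p b) (b≺q : Lt ε b q) (q≺c : Lt ε q c)
                     (y∈ : T (W (v ++ p ∷ b ∷ a ∷ c ∷ q ∷ w))) (z∈ : T (W (v ++ p ∷ a ∷ c ∷ b ∷ q ∷ w)))
                     (e : E (3 + length v) (v ++ p ∷ b ∷ a ∷ c ∷ q ∷ w) (v ++ p ∷ a ∷ c ∷ b ∷ q ∷ w))
                     (i≤ : 4 + length v ≤ n ∸ 1) where

    private
      l = length v
      y z : V
      y = _ , y∈
      z = _ , z∈

      _≺_ : ℕ → ℕ → Set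
      x ≺ x′ = Lt ε x x′

      tr : ∀ {x x′ x″} → x ≺ x′ → x′ ≺ x″ → x ≺ x″
      tr = Lt-trans ε

      up : ∀ {x x′} → x ≺ x′ → sgn x x′ ≡ ε
      up = sgn-up ε

      down : ∀ {x x′} → x′ ≺ x → sgn x x′ ≡ neg ε
      down = sgn-down ε

      a≺b = tr a≺p p≺b
      b≺c = tr b≺q q≺c
      a≺c = tr a≺b b≺c
      p≺c = tr p≺b b≺c
      a≺q = tr a≺b b≺q

      edge-at : ∀ (r : Word) {a b c s t} w → Lt ε a b → Lt ε b c → Triple a b c s t → length r ≤ 2 →
                T (W (v ++ r ++ t ++ w)) →
                Σ Word λ t′ → Triple a b c (neg s) t′ × E (2 + (length r + l)) (v ++ r ++ t ++ w) (v ++ r ++ t′ ++ w)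
      edge-at r {t = t} w a≺b b≺c abc r≤ u∈ with neighbour-Lt ε (v ++ r) w a≺b b≺c abc
        (subst (λ k → 2 + k ≤ n ∸ 1) (sym len) (≤-trans (s≤s (s≤s (+-monoˡ-≤ l r≤))) i≤)) (subst (T ∘ W) (sym (++-assoc v r _)) u∈)
        where
        len : length (v ++ r) ≡ length r + l
        len = trans (length-++ v) (+-comm l (length r))
      ... | t′ , abc′ , e = t′ , abc′ ,
        subst₂ (E _) (++-assoc v r _) (++-assoc v r _)
          (subst (λ k → E (2 + k) ((v ++ r) ++ t ++ w) ((v ++ r) ++ t′ ++ w)) (trans (length-++ v) (+-comm l (length r))) e)

      signs₀ : ∀ {s s′ s″ x₁ x₂ x₃ x₄ xs} (u∈ : T (W (v ++ x₁ ∷ x₂ ∷ x₃ ∷ x₄ ∷ xs))) →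
               sgn x₁ x₂ ≡ s → sgn x₂ x₃ ≡ s′ → sgn x₃ x₄ ≡ s″ → Signs l (_ , u∈) s s′ s″
      signs₀ _ eq₁ eq₂ eq₃ = trans (wordSig-++ v 0) eq₁ , trans (wordSig-++ v 1) eq₂ , trans (wordSig-++ v 2) eq₃

      signs₁ : ∀ {s s′ s″ x₀ x₁ x₂ x₃ x₄ xs} (u∈ : T (W (v ++ x₀ ∷ x₁ ∷ x₂ ∷ x₃ ∷ x₄ ∷ xs))) →
               sgn x₁ x₂ ≡ s → sgn x₂ x₃ ≡ s′ → sgn x₃ x₄ ≡ s″ → Signs (suc l) (_ , u∈) s s′ s″
      signs₁ _ eq₁ eq₂ eq₃ = trans (wordSig-++ v 1) eq₁ , trans (wordSig-++ v 2) eq₂ , trans (wordSig-++ v 3) eq₃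

      target : ∀ {i u x} → E i u x → T (W x)
      target e = proj₂ (E-vert e)

    private
      initial₁ : Σ V λ x → E (2 + l) (proj₁ y) (proj₁ x) × Signs l x (neg ε) ε ε
      initial₁ with edge-at [] (c ∷ q ∷ w) a≺p p≺b bca′ z≤n y∈
      ... | _ , bac′ , e = (_ , target e) , e , signs₀ (target e) (down a≺p) (up a≺b) (up b≺c)
      ... | _ , cab′ , e = (_ , target e) , e , signs₀ (target e) (down a≺b) (up a≺p) (up p≺c)

      final₁ : Σ V λ x → Σ V λ x′ → E (2 + l) (proj₁ z) (proj₁ x) × E (3 + l) (proj₁ x) (proj₁ x′) ×
               Signs l x ε (neg ε) ε × Signs l x′ ε ε (neg ε)
      final₁ with edge-at [] (b ∷ q ∷ w) a≺p p≺c bac′ z≤n z∈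
      final₁ | _ , acb′ , e₁ with edge-at (a ∷ []) (q ∷ w) p≺b b≺c cab′ (s≤s z≤n) (target e₁)
      ... | _ , acb′ , e₂ = (_ , target e₁) , (_ , target e₂) , e₁ , e₂ ,
        signs₀ (target e₁) (up a≺c) (down p≺c) (up p≺b) , signs₀ (target e₂) (up a≺p) (up p≺c) (down b≺c)
      ... | _ , bca′ , e₂ = (_ , target e₁) , (_ , target e₂) , e₁ , e₂ ,
        signs₀ (target e₁) (up a≺c) (down p≺c) (up p≺b) , signs₀ (target e₂) (up a≺b) (up b≺c) (down p≺c)
      final₁ | _ , bca′ , e₁ with edge-at (p ∷ []) (q ∷ w) a≺b b≺c cab′ (s≤s z≤n) (target e₁)
      -- This choice would lead back to `z`, whose only neighbour of this colour is `y`; comparing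
      -- the letters after `p` would give `b ≡ c`.
      ... | _ , acb′ , e₂ = contradiction
        (proj₁ (∷-injective (proj₂ (∷-injective (++-cancelˡ v _ _ (E-functional D (E-sym e) (E-sym e₂))))))) (Lt⇒≢ ε b≺c)
      ... | _ , bca′ , e₂ = (_ , target e₁) , (_ , target e₂) , e₁ , e₂ ,
        signs₀ (target e₁) (up p≺c) (down a≺c) (up a≺b) , signs₀ (target e₂) (up p≺b) (up b≺c) (down a≺c)

      final₂ : Σ V λ x → E (4 + l) (proj₁ z) (proj₁ x) × Signs (suc l) x ε ε (neg ε)
      final₂ with edge-at (p ∷ a ∷ []) w b≺q q≺c cab′ ≤-refl z∈
      ... | _ , acb′ , e = (_ , target e) , e , signs₁ (target e) (up a≺b) (up b≺c) (down q≺c)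
      ... | _ , bca′ , e = (_ , target e) , e , signs₁ (target e) (up a≺q) (up q≺c) (down b≺c)

      initial₂ : Σ V λ x → Σ V λ x′ → E (4 + l) (proj₁ y) (proj₁ x) × E (3 + l) (proj₁ x) (proj₁ x′) ×
                 Signs (suc l) x ε (neg ε) ε × Signs (suc l) x′ (neg ε) ε ε
      initial₂ with edge-at (p ∷ b ∷ []) w a≺q q≺c acb′ ≤-refl y∈
      initial₂ | _ , bac′ , e₁ with edge-at (p ∷ []) (c ∷ w) a≺b b≺q bca′ (s≤s z≤n) (target e₁)
      ... | _ , bac′ , e₂ = (_ , target e₁) , (_ , target e₂) , e₁ , e₂ ,
        signs₁ (target e₁) (up b≺q) (down a≺q) (up a≺c) , signs₁ (target e₂) (down a≺b) (up a≺q) (up q≺c)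
      ... | _ , cab′ , e₂ = (_ , target e₁) , (_ , target e₂) , e₁ , e₂ ,
        signs₁ (target e₁) (up b≺q) (down a≺q) (up a≺c) , signs₁ (target e₂) (down a≺q) (up a≺b) (up b≺c)
      initial₂ | _ , cab′ , e₁ with edge-at (p ∷ []) (q ∷ w) a≺b b≺c bca′ (s≤s z≤n) (target e₁)
      -- Likewise, this choice would lead back to `y`, whose only neighbour of this colour is `z`.
      ... | _ , bac′ , e₂ = contradiction
        (proj₁ (∷-injective (proj₂ (∷-injective (++-cancelˡ v _ _ (E-functional D e (E-sym e₂))))))) (Lt⇒≢ ε a≺b)
      ... | _ , cab′ , e₂ = (_ , target e₁) , (_ , target e₂) , e₁ , e₂ ,
        signs₁ (target e₁) (up b≺c) (down a≺c) (up a≺q) , signs₁ (target e₂) (down a≺c) (up a≺b) (up b≺q)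

    -- The edge between `y` and `z` has the upper colour in the first window and the lower colour in
    -- the second. It is therefore the second edge of this path and the third edge of `zigzag₂`.
    zigzag₁ : Zigzag ε l
    zigzag₁ with initial₁ | final₁
    ... | x₁ , e₁ , s₁ | x₄ , x₅ , e₄ , e₅ , s₄ , s₅ = record
      { x₁ = x₁ ; x₂ = y ; x₃ = z ; x₄ = x₄ ; x₅ = x₅
      ; e₁₂ = E-sym e₁ ; e₂₃ = e ; e₃₄ = e₄ ; e₄₅ = e₅
      ; s₁ = s₁ ; s₂ = signs₀ y∈ (up p≺b) (down a≺b) (up a≺c)
      ; s₃ = signs₀ z∈ (down a≺p) (up a≺c) (down b≺c) ; s₄ = s₄ ; s₅ = s₅ }

    zigzag₂ : Zigzag ε (suc l)
    zigzag₂ with initial₂ | final₂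
    ... | x₂ , x₁ , e₂ , e₁ , s₂ , s₁ | x₅ , e₅ , s₅ = record
      { x₁ = x₁ ; x₂ = x₂ ; x₃ = y ; x₄ = z ; x₅ = x₅
      ; e₁₂ = E-sym e₁ ; e₂₃ = E-sym e₂ ; e₃₄ = e ; e₄₅ = e₅
      ; s₁ = s₁ ; s₂ = s₂ ; s₃ = signs₁ y∈ (down a≺b) (up a≺c) (down q≺c)
      ; s₄ = signs₁ z∈ (up a≺c) (down b≺c) (up b≺q) ; s₅ = s₅ }

module _ {N n : ℕ} (D : D0Graph N n) where
  open D0Graph D

  private
    G = toSCG D
    V = SCG.V G

    Agree : ℕ → V → Set
    Agree l x = Σ Sign λ ε → (Σ (Zigzag D ε l) λ z → x ∈ Zigzag.vertices z) ×
                             (Σ (Zigzag D ε (suc l)) λ z → x ∈ Zigzag.vertices z)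

    agree-five : ∀ ε v w {a p b q c} → Lt ε a p → Lt ε p b → Lt ε b q → Lt ε q c →
                 (y∈ : T (W (v ++ p ∷ b ∷ a ∷ c ∷ q ∷ w))) (z∈ : T (W (v ++ p ∷ a ∷ c ∷ b ∷ q ∷ w))) →
                 E (3 + length v) (v ++ p ∷ b ∷ a ∷ c ∷ q ∷ w) (v ++ p ∷ a ∷ c ∷ b ∷ q ∷ w) →
                 4 + length v ≤ n ∸ 1 → Agree (length v) (_ , y∈) × Agree (length v) (_ , z∈)
    agree-five ε v w a≺p p≺b b≺q q≺c y∈ z∈ e i≤ =
      (ε , (zigzag₁ , there (here refl)) , (zigzag₂ , there (there (here refl)))) ,
      (ε , (zigzag₁ , there (there (here refl))) , (zigzag₂ , there (there (there (here refl)))))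
      where open FiveLetters D ε v w a≺p p≺b b≺q q≺c y∈ z∈ e i≤

    -- Both outer comparisons flip, so both outer letters of the triple must change. This excludes
    -- acb with cab, which end in the same letter, and bca with bac, which begin with the same
    -- letter. The pair acb, bac is the case `ε = plus` of `agree-five`, and bca, cab is the case
    -- `minus`.
    agree-triple : ∀ v p {a b c t t′} q w → a < b → b < c → Triple a b c plus t → Triple a b c minus t′ →
                   (u∈ : T (W (v ++ p ∷ t ++ q ∷ w))) (x∈ : T (W (v ++ p ∷ t′ ++ q ∷ w))) →
                   E (3 + length v) (v ++ p ∷ t ++ q ∷ w) (v ++ p ∷ t′ ++ q ∷ w) → 4 + length v ≤ n ∸ 1 →
                   sgn p (nth (t ++ q ∷ w) 0) ≢ sgn p (nth (t′ ++ q ∷ w) 0) →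
                   sgn (nth (t ++ q ∷ w) 2) q ≢ sgn (nth (t′ ++ q ∷ w) 2) q →
                   Agree (length v) (_ , u∈) × Agree (length v) (_ , x∈)
    agree-triple v p {t = t} {t′} q w a<b b<c tr tr′ u∈ x∈ e i≤ ne₁ ne₂
      with sgn-mono (λ p< → <-≤-trans p< (Triple-first (q ∷ w) a<b b<c tr tr′)) ne₁
         | sgn-mono {y = q} {v = q} (λ <q → ≤-<-trans (Triple-last (q ∷ w) a<b b<c tr tr′) <q) (ne₂ ∘ sym)
         | Unique-++⁻ʳ v (word-unique D u∈)
    ... | first≤p , p<first | q≤last , last<q | uniq =
      go tr tr′ u∈ x∈ e (sgn-minus⁻ first≤p) (sgn-plus⁻ p<first) (sgn-minus⁻ q≤last) (sgn-plus⁻ last<q) uniq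
      where
      go : ∀ {t t′} → Triple _ _ _ plus t → Triple _ _ _ minus t′ →
           (u∈ : T (W (v ++ p ∷ t ++ q ∷ w))) (x∈ : T (W (v ++ p ∷ t′ ++ q ∷ w))) →
           E (3 + length v) (v ++ p ∷ t ++ q ∷ w) (v ++ p ∷ t′ ++ q ∷ w) →
           nth (t ++ q ∷ w) 0 ≤ p → p < nth (t′ ++ q ∷ w) 0 → q ≤ nth (t′ ++ q ∷ w) 2 → nth (t ++ q ∷ w) 2 < q →
           Unique (p ∷ t ++ q ∷ w) → Agree (length v) (_ , u∈) × Agree (length v) (_ , x∈)
      go acb′ bac′ u∈ x∈ e a≤p p<b q≤c b<q ((p≢a ∷ _) ∷ _ ∷ (_ ∷ c≢q ∷ _) ∷ _) =
        let y , z = agree-five plus v w (≤∧≢⇒< a≤p (p≢a ∘ sym)) p<b b<q (≤∧≢⇒< q≤c (c≢q ∘ sym)) x∈ u∈ (E-sym e) i≤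
        in z , y
      go acb′ cab′ _ _ _ _ _ q≤b b<q _ = contradiction q≤b (<⇒≱ b<q)
      go bca′ bac′ _ _ _ b≤p p<b _ _ _ = contradiction b≤p (<⇒≱ p<b)
      go bca′ cab′ u∈ x∈ e b≤p p<c q≤b a<q ((p≢b ∷ _) ∷ (_ ∷ _ ∷ b≢q ∷ _) ∷ _) =
        agree-five minus v w p<c (≤∧≢⇒< b≤p (p≢b ∘ sym)) (≤∧≢⇒< q≤b (b≢q ∘ sym)) a<q u∈ x∈ e i≤

    -- A triple of colour `3 + l` is preceded by `l + 1` letters, the last of which is `p`, and
    -- `4 + l ≤ n ∸ 1` leaves a letter `q` after it. If the sign at `u` is `minus`, the edge is read
    -- backwards.
    agree : ∀ l {i u x} → i ≡ 3 + l → 4 + l ≤ n ∸ 1 → EdgeView i u x → (u∈ : T (W u)) → T (W x) → E i u x →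
            wordSig u (1 + l) ≢ wordSig x (1 + l) → wordSig u (4 + l) ≢ wordSig x (4 + l) → Agree l (u , u∈)
    agree l i≡ i≤ (view {s = s} {t} {t′} v₀ w₀ a<b b<c tr tr′) u∈ x∈ e ne₁ ne₂
      with ++-splitAt l v₀ (≤-trans (n≤1+n l) (≤-reflexive (sym (suc-injective (suc-injective i≡)))))
    ... | v , r , refl , refl with singleton r (+-cancelˡ-≡ (length v) _ _ (trans (sym (length-++ v)) (trans (suc-injective (suc-injective i≡)) (+-comm 1 (length v)))))
      where
      singleton : ∀ (r : Word) → length r ≡ 1 → ∃ λ p → r ≡ p ∷ []
      singleton (p ∷ []) _ = p , refl
    ...   | p , refl with nonempty w₀ (+-cancelˡ-≤ (length v + 4) _ _ (begin
        length v + 4 + 1                            ≡⟨ trans (+-assoc (length v) 4 1) (+-comm (length v) 5) ⟩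
        5 + length v                                ≤⟨ s≤s i≤ ⟩
        suc (n ∸ 1)                                 ≡⟨ m+[n∸m]≡n (≤-trans (s≤s z≤n) (≤-trans i≤ (m∸n≤m n 1))) ⟩
        n                                           ≡⟨ word-length D u∈ ⟨
        length ((v ++ p ∷ []) ++ t ++ w₀)           ≡⟨ length-++ (v ++ p ∷ []) ⟩
        length (v ++ p ∷ []) + length (t ++ w₀)     ≡⟨ cong₂ _+_ (length-++ v) (trans (length-++ t) (cong (_+ length w₀) (Triple-length tr))) ⟩
        length v + 1 + (3 + length w₀)              ≡⟨ trans (sym (+-assoc (length v + 1) 3 _)) (cong (_+ length w₀) (+-assoc (length v) 1 3)) ⟩
        length v + 4 + length w₀                    ∎))
      where
      open ≤-Reasoning
      nonempty : ∀ (w : Word) → 1 ≤ length w → ∃ λ q → ∃ λ w′ → w ≡ q ∷ w′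
      nonempty (q ∷ w) _ = q , w , refl
    ...     | q , w , refl = subst (Agree (length v)) (V-≡ D (sym u≡)) (go s tr tr′ e′ ne₁′ ne₂′)
      where
      u≡ : (v ++ p ∷ []) ++ t ++ q ∷ w ≡ v ++ p ∷ t ++ q ∷ w
      u≡ = ++-assoc v (p ∷ []) _
      x≡ : (v ++ p ∷ []) ++ t′ ++ q ∷ w ≡ v ++ p ∷ t′ ++ q ∷ w
      x≡ = ++-assoc v (p ∷ []) _
      u∈′ = subst (T ∘ W) u≡ u∈
      x∈′ = subst (T ∘ W) x≡ x∈
      e′ : E (3 + length v) (v ++ p ∷ t ++ q ∷ w) (v ++ p ∷ t′ ++ q ∷ w)
      e′ = subst₂ (E _) u≡ x≡ (subst (λ i → E i ((v ++ p ∷ []) ++ t ++ q ∷ w) ((v ++ p ∷ []) ++ t′ ++ q ∷ w)) i≡ e)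
      left : ∀ {t} → wordSig ((v ++ p ∷ []) ++ t ++ q ∷ w) (1 + length v) ≡ sgn p (nth (t ++ q ∷ w) 0)
      left {t} = trans (cong (λ u → wordSig u (1 + length v)) (++-assoc v (p ∷ []) (t ++ q ∷ w))) (wordSig-++ v 0)
      right : ∀ {s t} → Triple _ _ _ s t → wordSig ((v ++ p ∷ []) ++ t ++ q ∷ w) (4 + length v) ≡ sgn (nth (t ++ q ∷ w) 2) q
      right {t = t} tr = trans (cong (λ u → wordSig u (4 + length v)) (++-assoc v (p ∷ []) (t ++ q ∷ w)))
        (trans (wordSig-++ v 3) (cong (sgn (nth (t ++ q ∷ w) 2)) (Triple-nth (q ∷ w) 0 tr)))
      ne₁′ : sgn p (nth (t ++ q ∷ w) 0) ≢ sgn p (nth (t′ ++ q ∷ w) 0)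
      ne₁′ eq = ne₁ (trans (left {t}) (trans eq (sym (left {t′}))))
      ne₂′ : sgn (nth (t ++ q ∷ w) 2) q ≢ sgn (nth (t′ ++ q ∷ w) 2) q
      ne₂′ eq = ne₂ (trans (right tr) (trans eq (sym (right tr′))))
      go : ∀ s → Triple _ _ _ s t → Triple _ _ _ (neg s) t′ →
           E (3 + length v) (v ++ p ∷ t ++ q ∷ w) (v ++ p ∷ t′ ++ q ∷ w) →
           sgn p (nth (t ++ q ∷ w) 0) ≢ sgn p (nth (t′ ++ q ∷ w) 0) →
           sgn (nth (t ++ q ∷ w) 2) q ≢ sgn (nth (t′ ++ q ∷ w) 2) q → Agree (length v) (_ , u∈′)
      go plus  tr tr′ e ne₁ ne₂ = proj₁ (agree-triple v p q w a<b b<c tr tr′ u∈′ x∈′ e i≤ ne₁ ne₂)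
      go minus tr tr′ e ne₁ ne₂ = proj₂ (agree-triple v p q w a<b b<c tr′ tr x∈′ u∈′ (E-sym e) i≤ (ne₁ ∘ sym) (ne₂ ∘ sym))

  axiom4a : Axiom4a G
  axiom4a (suc (suc (suc (suc l)))) (s≤s (s≤s (s≤s (s≤s _)))) i≤ (u , u∈) (x , x∈) e _ ne₁ ne₂ L₁ L₂ comp₁ comp₂ α (len , _)
    with agree l refl i≤ (edge-view D e) u∈ x∈ e ne₁ ne₂
  ... | ε , (z₁ , u∈₁) , (z₂ , u∈₂) = trans
    (Zigzag.generatingFunction z₁ u∈₁ comp₁ α len)
    (sym (Zigzag.generatingFunction z₂ u∈₂ (subst (λ j → IsComponent G (2 + l) j (u , u∈) L₂) (+-comm (4 + l) 1) comp₂) α len))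

-- The certificates were found by computer: the permutations by search and the
-- corrections by linear algebra.

shapes₄ : List (List ℕ × List ℕ)
shapes₄ =
    (4 ∷ [] , 1234 ∷ [])
  ∷ (3 ∷ 1 ∷ [] , 1324 ∷ 1423 ∷ 2341 ∷ [])
  ∷ (2 ∷ 2 ∷ [] , 2143 ∷ 3412 ∷ [])
  ∷ (2 ∷ 1 ∷ 1 ∷ [] , 3214 ∷ 4132 ∷ 4231 ∷ [])
  ∷ (1 ∷ 1 ∷ 1 ∷ 1 ∷ [] , 4321 ∷ [])
  ∷ []

corrections₄ : List (List ℕ × List ℕ × List ℕ)
corrections₄ =
    ((1 ∷ []) ,
      [] ,
      (21234 ∷ 21243 ∷ 32134 ∷ []))
  ∷ ((2 ∷ []) ,
      [] ,
      (32134 ∷ []))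
  ∷ ((3 ∷ []) ,
      (31234 ∷ []) ,
      [])
  ∷ ((1 ∷ 2 ∷ []) ,
      [] ,
      (34123 ∷ []))
  ∷ ((1 ∷ 3 ∷ []) ,
      (33124 ∷ []) ,
      [])
  ∷ ((2 ∷ 3 ∷ []) ,
      (21342 ∷ 22341 ∷ 33124 ∷ []) ,
      [])
  ∷ []

shapes₅ : List (List ℕ × List ℕ)
shapes₅ =
    (5 ∷ [] , 12345 ∷ [])
  ∷ (4 ∷ 1 ∷ [] , 12435 ∷ 13425 ∷ 15234 ∷ 23451 ∷ [])
  ∷ (3 ∷ 2 ∷ [] , 21354 ∷ 21453 ∷ 34125 ∷ 35124 ∷ 45123 ∷ [])
  ∷ (3 ∷ 1 ∷ 1 ∷ [] , 14325 ∷ 15324 ∷ 15423 ∷ 32451 ∷ 42351 ∷ 52341 ∷ [])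
  ∷ (2 ∷ 2 ∷ 1 ∷ [] , 32154 ∷ 35412 ∷ 42153 ∷ 45312 ∷ 52143 ∷ [])
  ∷ (2 ∷ 1 ∷ 1 ∷ 1 ∷ [] , 15432 ∷ 43251 ∷ 52431 ∷ 53421 ∷ [])
  ∷ (1 ∷ 1 ∷ 1 ∷ 1 ∷ 1 ∷ [] , 54321 ∷ [])
  ∷ []

corrections₅ : List (List ℕ × List ℕ × List ℕ)
corrections₅ =
    ((1 ∷ []) ,
      [] ,
      (212345 ∷ 212435 ∷ 212534 ∷ 312345 ∷ 321345 ∷ 321354 ∷ 423145 ∷ []))
  ∷ ((2 ∷ []) ,
      [] ,
      (312345 ∷ 321345 ∷ 321354 ∷ 421345 ∷ 423145 ∷ []))
  ∷ ((3 ∷ []) ,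
      (212354 ∷ 212453 ∷ 213452 ∷ 223451 ∷ 312354 ∷ 331254 ∷ 341253 ∷ 431245 ∷ 432145 ∷
       441235 ∷ 442135 ∷ []) ,
      (213425 ∷ 223415 ∷ 414235 ∷ 423145 ∷ 424135 ∷ 434125 ∷ []))
  ∷ ((4 ∷ []) ,
      (312354 ∷ 412345 ∷ 413245 ∷ []) ,
      [])
  ∷ ((1 ∷ 2 ∷ []) ,
      [] ,
      (213425 ∷ 213524 ∷ 214523 ∷ 331245 ∷ 331254 ∷ 341235 ∷ 341253 ∷ 351234 ∷ 351243 ∷
       432145 ∷ 442135 ∷ 452134 ∷ []))
  ∷ ((1 ∷ 3 ∷ []) ,
      [] ,
      (213425 ∷ 213524 ∷ 214523 ∷ 234512 ∷ 421345 ∷ 432145 ∷ 442135 ∷ 452134 ∷ []))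
  ∷ ((1 ∷ 4 ∷ []) ,
      (431245 ∷ 441235 ∷ 451234 ∷ []) ,
      (213425 ∷ 213524 ∷ 214523 ∷ []))
  ∷ ((2 ∷ 3 ∷ []) ,
      (223415 ∷ 223514 ∷ 224513 ∷ []) ,
      (432145 ∷ 442135 ∷ 452134 ∷ []))
  ∷ ((2 ∷ 4 ∷ []) ,
      (212354 ∷ 212453 ∷ 213452 ∷ 223451 ∷ 223514 ∷ 224513 ∷ 331254 ∷ 341253 ∷ 415234 ∷
       425134 ∷ 431245 ∷ 435124 ∷ 441235 ∷ 445123 ∷ []) ,
      (213425 ∷ 452134 ∷ []))
  ∷ ((3 ∷ 4 ∷ []) ,
      (223451 ∷ 223541 ∷ 312453 ∷ 313452 ∷ 323451 ∷ 332451 ∷ 414235 ∷ 415234 ∷ []) ,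
      [])
  ∷ ((1 ∷ 2 ∷ 3 ∷ []) ,
      [] ,
      (214532 ∷ 341352 ∷ 351342 ∷ 352341 ∷ 443125 ∷ 453124 ∷ 454123 ∷ []))
  ∷ ((1 ∷ 2 ∷ 4 ∷ []) ,
      [] ,
      (214532 ∷ 234512 ∷ 341352 ∷ 351342 ∷ 352341 ∷ []))
  ∷ ((1 ∷ 3 ∷ 4 ∷ []) ,
      (223415 ∷ 223514 ∷ 224513 ∷ 321453 ∷ 331452 ∷ 342351 ∷ 424135 ∷ 425134 ∷ 434125 ∷
       435124 ∷ 445123 ∷ []) ,
      (214532 ∷ 223451 ∷ 223541 ∷ 432145 ∷ 442135 ∷ 452134 ∷ []))
  ∷ ((2 ∷ 3 ∷ 4 ∷ []) ,
      (224531 ∷ 234521 ∷ 342351 ∷ []) ,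
      [])
  ∷ []

-- Evaluation of the certificates and conclusion

certificate₄ certificate₅ : Certificate
certificate₄ = record { shapes = shapes₄ ; corrections = corrections₄ }
certificate₅ = record { shapes = shapes₅ ; corrections = corrections₅ }

isPartition? : ∀ d μ → Dec (IsPartition d μ)
isPartition? d μ = (sum μ ≟ d) ×-dec All.all? (1 ≤?_) μ ×-dec Linked.linked? (λ a b → b ≤? a) μ

shapes₄-partitions : All (IsPartition 4) (map proj₁ shapes₄)
shapes₄-partitions = toWitness {a? = All.all? (isPartition? 4) (map proj₁ shapes₄)} tt

shapes₅-partitions : All (IsPartition 5) (map proj₁ shapes₅)
shapes₅-partitions = toWitness {a? = All.all? (isPartition? 5) (map proj₁ shapes₅)} tt

lsp4 : ∀ {N n} (D : D0Graph N n) → LSP (toSCG D) 4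
lsp4 D = certificate⇒LSP D certificate₄ 4 refl (s≤s z≤n) shapes₄-partitions

lsp5 : ∀ {N n} (D : D0Graph N n) → LSP (toSCG D) 5
lsp5 D = certificate⇒LSP D certificate₅ 5 refl (s≤s z≤n) shapes₅-partitions

theorem4p10 : ∀ (N n : ℕ) (D : D0Graph N n) →
    (Axiom1 (toSCG D) × Axiom2 (toSCG D) × Axiom3 (toSCG D) × Axiom4a (toSCG D) ×
    LSP (toSCG D) 4 × LSP (toSCG D) 5) ×
    ((IsDGraph (toSCG D) → Axiom4b (toSCG D) × Axiom5 (toSCG D)) ×
    (Axiom4b (toSCG D) × Axiom5 (toSCG D) → IsDGraph (toSCG D)))
theorem4p10 N n D =
  (axiom1 D , axiom2 D , axiom3 D , axiom4a D , lsp4 D , lsp5 D) ,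
  (λ (_ , _ , _ , _ , ax4b , ax5 , _) → ax4b , ax5) ,
  (λ (ax4b , ax5) → axiom1 D , axiom2 D , axiom3 D , axiom4a D , ax4b , ax5 , lsp4 D , lsp5 D)
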